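{- For every odd integer $t\ge 1$, with $g=6+2t$, there exist two half-regular bipartite graphs $G_1$ and $G_2$ that have the same spectrum, the same degree sequences and the same girth $g$, but have different numbers of $g$-cycles. Specifically, let $G_1$ be the disjoint union of two cycles, each of length $6+2t$, and two paths, each of length $5+t$ (number of edges), and let $G_2$ be the disjoint union of a $(6+2t)$-cycle, a $(14+2t)$-cycle and two paths, each of length $t+1$. Then $G_1$ and $G_2$ have these properties, with two $g$-cycles in $G_1$ and one $g$-cycle in $G_2$.
   Context: All graphs are finite, simple and undirected. The length of a path or cycle is its number of edges. The spectrum of a graph is the multiset of eigenvalues of its adjacency matrix. The degree sequences of a bipartite graph are the two monotonic non-increasing sequences of the node degrees on the two sides of a bipartition; two graphs have the same degree sequences if these coincide for suitable bipartitions. A bipartite graph is half-regular if, for a suitable bipartition, all nodes on one side have the same degree. Half-regular graphs are regarded as not bi-regular (bi-regular meaning that all nodes on the same side have the same degree, for both sides). A $g$-cycle is a cycle of length $g$, cycles being counted as subgraphs. The girth is the length of a shortest cycle. -}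

module Defs where

open import Algebra.Apartness.Bundles using (HeytingField; HeytingCommutativeRing)
open import Algebra.Bundles using (CommutativeRing)
import Algebra.Definitions.RawMonoid as RawMonoidDefinitions
open import Data.Bool.Base using (Bool; if_then_else_)
import Data.Bool.Properties as Bool
open import Data.Fin.Base using (Fin; toℕ; splitAt)
open import Data.List.Base using (List; allFin; filter; length; map)
import Data.List.Sort as Sort
open import Data.Nat.Base as ℕ using (ℕ; suc; s≤s; z≤n; _≤_)
import Data.Nat.Properties as ℕ
open import Data.Product.Base using (Σ-syntax; ∃; ∃₂; ∃-syntax; _×_; _,_)
open import Data.Sum.Base using (_⊎_; inj₁; inj₂; swap)
open import Data.Sum.Relation.Binary.Pointwise
  using (Pointwise; ⊎-symmetric; ⊎-decidable)
open import Data.Vec.Functional using (Vector)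
open import Function.Base using (_∘_)
open import Function.Bundles using (Bijection; _⇔_; mk⇔; Equivalence)
open import Function.Definitions using (Injective)
open import Level using (Level; 0ℓ; _⊔_) renaming (suc to lsuc)
open import Relation.Binary.Bundles using (Setoid)
import Relation.Binary.Construct.Flip.EqAndOrd as Flip
open import Relation.Binary.Core using (Rel)
open import Relation.Binary.Definitions using (Symmetric; Decidable)
open import Relation.Binary.PropositionalEquality
  using (_≡_; _≢_; refl; trans; cong; setoid)
  renaming (sym to ≡-sym)
open import Relation.Binary.Structures using (IsStrictPartialOrder)
open import Relation.Nullary using (¬_; does)
open import Relation.Nullary.Decidable using (_⊎-dec_; _×-dec_)

------------------------------------------------------------------------
-- Real numbers

-- The standard library has no real numbers.  They are characterised
-- axiomatically as a Cauchy-complete Archimedean ordered field, which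
-- determines them up to isomorphism.

record RealNumbers c ℓ₁ ℓ₂ : Set (lsuc (c ⊔ ℓ₁ ⊔ ℓ₂)) where
  field
    heytingField : HeytingField c ℓ₁ ℓ₂

  open HeytingField heytingField public
    using ( Carrier; _≈_; _#_; _+_; _*_; -_; _-_; 0#; 1#
          ; isHeytingField; heytingCommutativeRing )
  open HeytingCommutativeRing heytingCommutativeRing public
    using (commutativeRing)
  open RawMonoidDefinitions (CommutativeRing.+-rawMonoid commutativeRing) public
    using (sum) renaming (_×_ to _×ᴿ_)

  infix 4 _<_
  field
    _<_                  : Rel Carrier ℓ₂
    isStrictPartialOrder : IsStrictPartialOrder _≈_ _<_
    #⇔<⊎>                : ∀ {x y} → (x # y) ⇔ (x < y ⊎ y < x)
    +-monoˡ-<            : ∀ {x y} z → x < y → x + z < y + z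
    *-pos                : ∀ {x y} → 0# < x → 0# < y → 0# < x * y
    archimedean          : ∀ x → ∃[ n ] x < n ×ᴿ 1#

  -- Within ε x y expresses |x - y| < ε.
  Within : Carrier → Carrier → Carrier → Set ℓ₂
  Within ε x y = (x - y < ε) × (y - x < ε)

  IsCauchy : (ℕ → Carrier) → Set (c ⊔ ℓ₂)
  IsCauchy s = ∀ ε → 0# < ε →
    ∃[ N ] (∀ m n → N ≤ m → N ≤ n → Within ε (s m) (s n))

  ConvergesTo : (ℕ → Carrier) → Carrier → Set (c ⊔ ℓ₂)
  ConvergesTo s x = ∀ ε → 0# < ε →
    ∃[ N ] (∀ n → N ≤ n → Within ε (s n) x)

  field
    complete : ∀ s → IsCauchy s → ∃[ x ] ConvergesTo s x

------------------------------------------------------------------------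
-- Graphs

record Graph : Set₁ where
  field
    order  : ℕ
    Adj    : Rel (Fin order) 0ℓ
    adj?   : Decidable Adj
    sym    : Symmetric Adj
    irrefl : ∀ {v} → ¬ Adj v v

  Vertex : Set
  Vertex = Fin order

  degree : Vertex → ℕ
  degree v = length (filter (adj? v) (allFin order))

open Graph using (order; Vertex; Adj; adj?; degree)

PathAdj : ∀ {n} → Rel (Fin n) 0ℓ
PathAdj i j = toℕ j ≡ suc (toℕ i) ⊎ toℕ i ≡ suc (toℕ j)

-- The path of length ℓ has ℓ edges, hence suc ℓ vertices.
pathGraph : ℕ → Graph
pathGraph ℓ = record
  { order  = suc ℓ
  ; Adj    = PathAdj
  ; adj?   = λ i j → (toℕ j ℕ.≟ suc (toℕ i)) ⊎-dec (toℕ i ℕ.≟ suc (toℕ j))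
  ; sym    = swap
  ; irrefl = λ { (inj₁ eq) → ℕ.1+n≢n (≡-sym eq) ; (inj₂ eq) → ℕ.1+n≢n (≡-sym eq) }
  }

-- j is the cyclic successor of i.
CyclicSucc : ∀ {n} → Rel (Fin n) 0ℓ
CyclicSucc {n} i j = toℕ j ≡ suc (toℕ i) ⊎ (suc (toℕ i) ≡ n × toℕ j ≡ 0)

CycleAdj : ∀ {n} → Rel (Fin n) 0ℓ
CycleAdj i j = CyclicSucc i j ⊎ CyclicSucc j i

cycleGraph : ∀ n → 3 ≤ n → Graph
cycleGraph n 3≤n = record
  { order  = n
  ; Adj    = CycleAdj
  ; adj?   = λ i j → succ? i j ⊎-dec succ? j i
  ; sym    = swap
  ; irrefl = λ { (inj₁ s) → irr 3≤n s ; (inj₂ s) → irr 3≤n s }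
  }
  where
  succ? : Decidable (CyclicSucc {n})
  succ? i j = (toℕ j ℕ.≟ suc (toℕ i)) ⊎-dec ((suc (toℕ i) ℕ.≟ n) ×-dec (toℕ j ℕ.≟ 0))

  irr : ∀ {n} {i : Fin n} → 3 ≤ n → ¬ CyclicSucc i i
  irr _ (inj₁ eq) = ℕ.1+n≢n (≡-sym eq)
  irr 3≤n (inj₂ (i+1≡n , i≡0)) with trans (cong suc (≡-sym i≡0)) i+1≡n
  irr (s≤s ()) (inj₂ _) | refl

infixr 6 _⊕_

-- Disjoint union.
_⊕_ : Graph → Graph → Graph
G ⊕ H = record
  { order  = order G ℕ.+ order H
  ; Adj    = λ u v → Pointwise (Adj G) (Adj H) (split u) (split v)
  ; adj?   = λ u v → ⊎-decidable (adj? G) (adj? H) (split u) (split v)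
  ; sym    = ⊎-symmetric (Graph.sym G) (Graph.sym H)
  ; irrefl = λ {v} → irr (split v)
  }
  where
  split : Fin (order G ℕ.+ order H) → Vertex G ⊎ Vertex H
  split = splitAt (order G)

  irr : ∀ x → ¬ Pointwise (Adj G) (Adj H) x x
  irr (inj₁ _) (Pointwise.inj₁ a) = Graph.irrefl G a
  irr (inj₂ _) (Pointwise.inj₂ a) = Graph.irrefl H a

------------------------------------------------------------------------
-- Spectrum

module _ {c ℓ₁ ℓ₂} (ℝ : RealNumbers c ℓ₁ ℓ₂) where
  open RealNumbers ℝ using (Carrier; _≈_; _*_; 0#; 1#; sum)

  adjacencyMatrix : (G : Graph) → Vertex G → Vertex G → Carrier
  adjacencyMatrix G u v = if does (adj? G u v) then 1# else 0#

  InEigenspace : (G : Graph) → Carrier → Vector Carrier (order G) → Set ℓ₁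
  InEigenspace G x f =
    ∀ u → sum (λ v → adjacencyMatrix G u v * f v) ≈ x * f u

  linearCombination : ∀ {k n} → Vector Carrier k →
                      (Fin k → Vector Carrier n) → Vector Carrier n
  linearCombination a b v = sum (λ i → a i * b i v)

  LinearlyIndependent : ∀ {k n} → (Fin k → Vector Carrier n) → Set (c ⊔ ℓ₁)
  LinearlyIndependent b =
    ∀ a → (∀ v → linearCombination a b v ≈ 0#) → ∀ i → a i ≈ 0#

  -- The eigenspace of x has dimension k.  The adjacency matrix is real
  -- symmetric, so this dimension is the multiplicity of x as an
  -- eigenvalue; k is 0 exactly when x is not an eigenvalue.
  HasMultiplicity : Graph → Carrier → ℕ → Set (c ⊔ ℓ₁)
  HasMultiplicity G x k =
    Σ[ b ∈ (Fin k → Vector Carrier (order G)) ]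
      ( (∀ i → InEigenspace G x (b i))
      × LinearlyIndependent b
      × (∀ f → InEigenspace G x f →
           ∃[ a ] (∀ v → f v ≈ linearCombination a b v)) )

  -- The multisets of eigenvalues coincide: every real number has the
  -- same multiplicity in both.
  SameSpectrum : Graph → Graph → Set (c ⊔ ℓ₁)
  SameSpectrum G H = ∀ x k → HasMultiplicity G x k ⇔ HasMultiplicity H x k

------------------------------------------------------------------------
-- Bipartite graphs and degrees

record Bipartition (G : Graph) : Set where
  field
    side     : Vertex G → Bool
    crossing : ∀ {u v} → Adj G u v → side u ≢ side v

open Bipartition using (side)

SideRegular : ∀ {G} → Bipartition G → Bool → Set
SideRegular {G} B s = ∃[ d ] (∀ v → side B v ≡ s → degree G v ≡ d)

BiRegular : Graph → Set
BiRegular G = Σ[ B ∈ Bipartition G ] (∀ s → SideRegular B s)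

HalfRegular : Graph → Set
HalfRegular G = (Σ[ B ∈ Bipartition G ] ∃ (SideRegular B)) × ¬ BiRegular G

degreeSequence : ∀ {G} → Bipartition G → Bool → List ℕ
degreeSequence {G} B s =
  sortDescending (map (degree G) (filter (λ v → side B v Bool.≟ s) (allFin (order G))))
  where open Sort (Flip.decTotalOrder ℕ.≤-decTotalOrder) renaming (sort to sortDescending)

SameDegreeSequences : Graph → Graph → Set
SameDegreeSequences G H =
  Σ[ B ∈ Bipartition G ] Σ[ C ∈ Bipartition H ]
    (∀ s → degreeSequence B s ≡ degreeSequence C s)

------------------------------------------------------------------------
-- Cycles in a graph

-- A traversal of a subgraph of G isomorphic to the cycle of length g.
record Cycle (G : Graph) (g : ℕ) : Set where
  field
    3≤g       : 3 ≤ g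
    node      : Fin g → Vertex G
    injective : Injective _≡_ _≡_ node
    adjacent  : ∀ {i j} → CycleAdj i j → Adj G (node i) (node j)

  Edge : Rel (Vertex G) 0ℓ
  Edge u v = ∃₂ λ i j → CycleAdj i j × node i ≡ u × node j ≡ v

-- Two traversals are identified when they give the same subgraph, i.e.
-- have the same edges; the vertices are the endpoints of the edges.
cycleSetoid : Graph → ℕ → Setoid 0ℓ 0ℓ
cycleSetoid G g = record
  { Carrier       = Cycle G g
  ; _≈_           = λ C D → ∀ u v → Cycle.Edge C u v ⇔ Cycle.Edge D u v
  ; isEquivalence = record
    { refl  = λ _ _ → mk⇔ (λ e → e) (λ e → e)
    ; sym   = λ p u v → mk⇔ (from (p u v)) (to (p u v))
    ; trans = λ p q u v → mk⇔ (to (q u v) ∘ to (p u v)) (from (p u v) ∘ from (q u v))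
    }
  }
  where open Equivalence using (to; from)

HasGirth : Graph → ℕ → Set
HasGirth G g = Cycle G g × (∀ m → Cycle G m → g ≤ m)

-- G contains exactly N cycles of length g, counted as subgraphs.
NumberOfCycles : Graph → ℕ → ℕ → Set
NumberOfCycles G g N = Bijection (setoid (Fin N)) (cycleSetoid G g)

------------------------------------------------------------------------
-- The properties in question, and the specific graphs

record DistinguishedPair {c ℓ₁ ℓ₂} (ℝ : RealNumbers c ℓ₁ ℓ₂)
                         (g : ℕ) (G H : Graph) : Set (c ⊔ ℓ₁) where
  field
    halfRegular₁        : HalfRegular G
    halfRegular₂        : HalfRegular H
    sameSpectrum        : SameSpectrum ℝ G H
    sameDegreeSequences : SameDegreeSequences G H
    girth₁              : HasGirth G g
    girth₂              : HasGirth H g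
    differentCounts     : ∃₂ λ M N →
      NumberOfCycles G g M × NumberOfCycles H g N × M ≢ N

G₁ : ℕ → Graph
G₁ t = (C ⊕ C) ⊕ (P ⊕ P)
  where
  C = cycleGraph (6 ℕ.+ 2 ℕ.* t) (s≤s (s≤s (s≤s z≤n)))
  P = pathGraph (5 ℕ.+ t)

G₂ : ℕ → Graph
G₂ t = (C ⊕ D) ⊕ (P ⊕ P)
  where
  C = cycleGraph (6 ℕ.+ 2 ℕ.* t) (s≤s (s≤s (s≤s z≤n)))
  D = cycleGraph (14 ℕ.+ 2 ℕ.* t) (s≤s (s≤s (s≤s z≤n)))
  P = pathGraph (t ℕ.+ 1)

{-# OPTIONS --safe #-}

-- An eigenvector of a path or cycle for x is a piece of a solution of
-- f (k + 2) = x f (k + 1) - f k.  Let u m be the solution starting with 0, 1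
-- and let T be the transfer matrix, so that T^m - T^-m = u m (T - T^-1) and
-- (T - T^-1)² = x² - 4.  The eigenspace of the path with m - 1 vertices is
-- ker (u m), and that of the cycle of length 2m is
-- ker (T^2m - 1) = ker (u m (T - T^-1)).  Since u m and x² - 4 are coprime
-- polynomials, the latter is isomorphic to ker (T - T^-1) ⊞ ker (u m) ⊞ ker (u m),
-- uniformly in x, without deciding whether x is an eigenvalue.  With m = t + 3 and
-- m′ = t + 7, the eigenspaces of G₁ and G₂ are thus sums of the same spaces:
-- ker (T - T^-1) twice, ker (u m) four times and ker (u m′) twice.
module Submission where

open import Defs
open import Algebra.Apartness.Structures using (IsHeytingField)
open import Algebra.Bundles using (CommutativeRing; RawRing)
import Algebra.Properties.Monoid.Sum as MonoidSum
open import Algebra.Solver.Ring.AlmostCommutativeRing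
  using (fromCommutativeRing; _-Raw-AlmostCommutative⟶_; Induced-equivalence)
open import Data.Bool.Base using (Bool; true; false; not; if_then_else_)
import Data.Bool.Properties as Bool
open import Data.Fin.Base as Fin
  using (Fin; zero; suc; toℕ; fromℕ; fromℕ<; inject₁; _↑ˡ_; _↑ʳ_; splitAt)
open import Data.Fin.Induction using (<-weakInduction)
import Data.Fin.Properties as Fin
open import Data.List.Base as List
  using (List; []; _∷_; _++_; allFin; filter; length; map; replicate; tabulate)
import Data.List.Properties as List
open import Data.List.Membership.Propositional using (_∈_)
open import Data.List.Membership.Propositional.Properties
  using (∈-filter⁺; ∈-filter⁻; ∈-allFin; ∈-map⁺; ∈-map⁻)
open import Data.List.Membership.Propositional.Properties.WithK using (unique∧set⇒bag)
open import Data.List.Relation.Binary.BagAndSetEquality using (∼bag⇒↭)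
import Data.List.Relation.Binary.Permutation.Homogeneous as Homogeneous
open import Data.List.Relation.Binary.Permutation.Propositional as Perm
  using (_↭_; ↭-sym; ↭-trans; ↭-prep; ↭-reflexive; ↭⇒↭ₛ)
import Data.List.Relation.Binary.Permutation.Propositional.Properties as Perm
import Data.List.Relation.Binary.Permutation.Setoid.Properties as SetoidPerm
open import Data.List.Relation.Binary.Pointwise using (Pointwise-≡⇒≡)
open import Data.List.Relation.Unary.All using ([]; _∷_)
open import Data.List.Relation.Unary.AllPairs using ([]; _∷_)
open import Data.List.Relation.Unary.Any using (here; there)
open import Data.List.Relation.Unary.Sorted.TotalOrder.Properties using (↗↭↗⇒≋)
open import Data.List.Relation.Unary.Unique.Propositional using (Unique)
import Data.List.Relation.Unary.Unique.Propositional.Properties as Unique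
import Data.List.Sort as Sort
open import Data.Maybe.Base using (just; nothing)
open import Data.Nat.Base as ℕ using (ℕ; zero; suc; s≤s; z≤n)
open import Data.Nat.DivMod using (_/_; m≡m%n+[m/n]*n)
import Data.Nat.Properties as ℕ
open import Data.Nat.Solver using (module +-*-Solver)
open import Data.Product.Base using (∃; ∃₂; _×_; _,_; proj₁; proj₂)
open import Data.Sum.Base as Sum using (_⊎_; inj₁; inj₂; [_,_]; [_,_]′)
import Data.Sum.Relation.Binary.Pointwise as Pointwise
open Pointwise using (Pointwise)
open import Data.Unit.Base using (⊤; tt)
open import Data.Vec.Functional using (Vector)
open import Function.Base using (_∘_; id)
open import Function.Bundles using (Bijection; _⇔_; mk⇔; Equivalence)
open import Level as Level using (Level; _⊔_)
open import Relation.Binary.Bundles using (Setoid; DecTotalOrder)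
import Relation.Binary.Construct.Flip.EqAndOrd as Flip
open import Relation.Binary.Definitions using (WeaklyDecidable)
open import Relation.Binary.PropositionalEquality
  using (_≡_; _≢_; refl; sym; trans; cong; cong₂; subst; subst₂)
open import Relation.Binary.Structures using (IsStrictPartialOrder)
open import Relation.Nullary using (¬_; yes; no; does; contradiction)
open import Relation.Unary using (Decidable)

open Graph using (order; Vertex; Adj; adj?; degree)
open Bipartition using (side; crossing)

-- That `t` is odd matters twice. The path lengths `5 + t` and `t + 1` are then even, so both ends
-- of a path lie on one side and every vertex of the other side has degree 2; bi-regularity fails
-- because a cycle has adjacent vertices of degree 2 while a path has ends of degree 1. Moreover m =
-- t + 3 and m′ = t + 7 are then even, which gives coprimality a short certificate: `u (2n)` is n x
-- modulo x² - 4, and x (n x) - n (x² - 4) = 4n. The only division is by this positive number,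
-- invertible in an ordered field. The constants match crosswise: `14 + 2t` is twice m′, which is
-- one more than the number of vertices of a long path, and `6 + 2t` is twice m, which is one more
-- than that of a short path. Trading a cycle of length 2m and two long paths for a cycle of length
-- 2m′ and two short paths therefore keeps the spectrum. The other cycle of length 2m is common to
-- both graphs and makes the girths agree.

private variable
  G H : Graph
  m n : ℕ

-- Neighbourhoods and degrees

-- Degrees and rows of the adjacency matrix both range over all vertices. An explicit duplicate-free
-- list of neighbours determines both, as it is a permutation of the filtered list.
record NeighbourList (G : Graph) (u : Vertex G) (ns : List (Vertex G)) : Set where
  field
    unique : Unique ns
    adj⇒∈  : ∀ {v} → Adj G u v → v ∈ ns
    ∈⇒adj  : ∀ {v} → v ∈ ns → Adj G u v

open NeighbourList

neighbours : ∀ G (u : Vertex G) → List (Vertex G)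
neighbours G u = filter (adj? G u) (allFin (order G))

neighbours-list : ∀ {u} → NeighbourList G u (neighbours G u)
neighbours-list {G} {u} = record
  { unique = Unique.filter⁺ (adj? G u) (Unique.allFin⁺ (order G))
  ; adj⇒∈  = ∈-filter⁺ (adj? G u) (∈-allFin _)
  ; ∈⇒adj  = λ v∈ → proj₂ (∈-filter⁻ (adj? G u) {xs = allFin (order G)} v∈)
  }

neighbours-↭ : ∀ {u ns} → NeighbourList G u ns → neighbours G u ↭ ns
neighbours-↭ {G} nl = ∼bag⇒↭ (unique∧set⇒bag (unique nl′) (unique nl)
  (mk⇔ (adj⇒∈ nl ∘ ∈⇒adj nl′) (adj⇒∈ nl′ ∘ ∈⇒adj nl)))
  where nl′ = neighbours-list {G}

degree-length : ∀ {u ns} → NeighbourList G u ns → degree G u ≡ length ns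
degree-length nl = Perm.↭-length (neighbours-↭ nl)

soleNeighbour : ∀ {u v} → (∀ {w} → Adj G u w → w ≡ v) → Adj G u v →
                NeighbourList G u (v ∷ [])
soleNeighbour only adj = record
  { unique = [] ∷ []
  ; adj⇒∈  = here ∘ only
  ; ∈⇒adj  = λ { (here refl) → adj }
  }

twoNeighbours : ∀ {u v w} → v ≢ w → (∀ {z} → Adj G u z → z ≡ v ⊎ z ≡ w) →
                Adj G u v → Adj G u w → NeighbourList G u (v ∷ w ∷ [])
twoNeighbours v≢w only adj₁ adj₂ = record
  { unique = (v≢w ∷ []) ∷ [] ∷ []
  ; adj⇒∈  = λ a → [ here , there ∘ here ]′ (only a)
  ; ∈⇒adj  = λ { (here refl) → adj₁ ; (there (here refl)) → adj₂ }
  }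

-- Paths

module _ {ℓ : ℕ} {i : Vertex (pathGraph ℓ)} where

  path-inner : ∀ {h j : Vertex (pathGraph ℓ)} →
               toℕ j ≡ suc (toℕ i) → toℕ i ≡ suc (toℕ h) →
               NeighbourList (pathGraph ℓ) i (j ∷ h ∷ [])
  path-inner {h} {j} j≡1+i i≡1+h = twoNeighbours j≢h only (inj₁ j≡1+i) (inj₂ i≡1+h)
    where
    j≢h : j ≢ h
    j≢h refl = ℕ.<-asym (ℕ.≤-reflexive (sym j≡1+i)) (ℕ.≤-reflexive (sym i≡1+h))

    only : ∀ {z} → PathAdj i z → z ≡ j ⊎ z ≡ h
    only (inj₁ z≡1+i) = inj₁ (Fin.toℕ-injective (trans z≡1+i (sym j≡1+i)))
    only (inj₂ i≡1+z) = inj₂ (Fin.toℕ-injective (ℕ.suc-injective (trans (sym i≡1+z) i≡1+h)))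

  path-first : ∀ {j : Vertex (pathGraph ℓ)} → toℕ i ≡ 0 → toℕ j ≡ 1 →
               NeighbourList (pathGraph ℓ) i (j ∷ [])
  path-first {j} i≡0 j≡1 = soleNeighbour only (inj₁ (trans j≡1 (cong suc (sym i≡0))))
    where
    only : ∀ {z} → PathAdj i z → z ≡ j
    only (inj₁ z≡1+i) = Fin.toℕ-injective (trans (trans z≡1+i (cong suc i≡0)) (sym j≡1))
    only (inj₂ i≡1+z) = contradiction (trans (sym i≡0) i≡1+z) λ ()

  path-last : ∀ {h : Vertex (pathGraph ℓ)} → toℕ i ≡ ℓ → toℕ i ≡ suc (toℕ h) →
              NeighbourList (pathGraph ℓ) i (h ∷ [])
  path-last {h} i≡ℓ i≡1+h = soleNeighbour only (inj₂ i≡1+h)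
    where
    only : ∀ {z} → PathAdj i z → z ≡ h
    only {z} (inj₁ z≡1+i) = contradiction (Fin.toℕ<n z)
      (ℕ.≤⇒≯ (ℕ.≤-reflexive (trans (cong suc (sym i≡ℓ)) (sym z≡1+i))))
    only (inj₂ i≡1+z) = Fin.toℕ-injective (ℕ.suc-injective (trans (sym i≡1+z) i≡1+h))

-- Cycles

successor : ∀ (i : Fin n) → ∃ (CyclicSucc i)
successor {suc n} i with suc (toℕ i) ℕ.<? suc n
... | yes i+1<n = fromℕ< i+1<n , inj₁ (Fin.toℕ-fromℕ< i+1<n)
... | no  i+1≮n = zero , inj₂ (ℕ.≤-antisym (Fin.toℕ<n i) (ℕ.≮⇒≥ i+1≮n) , refl)

predecessor : ∀ (i : Fin n) → ∃ λ h → CyclicSucc h i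
predecessor {suc n} zero    = fromℕ n , inj₂ (cong suc (Fin.toℕ-fromℕ n) , refl)
predecessor         (suc i) = inject₁ i , inj₁ (cong suc (sym (Fin.toℕ-inject₁ i)))

successor-unique : ∀ {i j k : Fin n} → CyclicSucc i j → CyclicSucc i k → j ≡ k
successor-unique (inj₁ p) (inj₁ q) = Fin.toℕ-injective (trans p (sym q))
successor-unique {j = j} (inj₁ p) (inj₂ (q , _)) =
  contradiction (Fin.toℕ<n j) (ℕ.≤⇒≯ (ℕ.≤-reflexive (trans (sym q) (sym p))))
successor-unique {k = k} (inj₂ (p , _)) (inj₁ q) =
  contradiction (Fin.toℕ<n k) (ℕ.≤⇒≯ (ℕ.≤-reflexive (trans (sym p) (sym q))))
successor-unique (inj₂ (_ , p)) (inj₂ (_ , q)) = Fin.toℕ-injective (trans p (sym q))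

predecessor-unique : ∀ {i j k : Fin n} → CyclicSucc j i → CyclicSucc k i → j ≡ k
predecessor-unique (inj₁ p) (inj₁ q) = Fin.toℕ-injective (ℕ.suc-injective (trans (sym p) q))
predecessor-unique (inj₁ p) (inj₂ (_ , q)) = contradiction (trans (sym q) p) λ ()
predecessor-unique (inj₂ (_ , p)) (inj₁ q) = contradiction (trans (sym p) q) λ ()
predecessor-unique (inj₂ (p , _)) (inj₂ (q , _)) =
  Fin.toℕ-injective (ℕ.suc-injective (trans p (sym q)))

-- A wrap-around in one direction forces `n` to be 2, and in both directions to be 1. This keeps the
-- two neighbours of a vertex on a cycle distinct.
successor-asym : ∀ {i j : Fin n} → 3 ℕ.≤ n → CyclicSucc i j → ¬ CyclicSucc j i
successor-asym 3≤n (inj₁ p) (inj₁ q) =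
  ℕ.<-asym (ℕ.≤-reflexive (sym p)) (ℕ.≤-reflexive (sym q))
successor-asym 3≤n (inj₁ p) (inj₂ (q , i≡0)) rewrite i≡0 | p | sym q = case 3≤n
  where case : ¬ 3 ℕ.≤ 2
        case (s≤s (s≤s ()))
successor-asym 3≤n (inj₂ (p , j≡0)) (inj₁ q) rewrite j≡0 | q | sym p = case 3≤n
  where case : ¬ 3 ℕ.≤ 2
        case (s≤s (s≤s ()))
successor-asym 3≤n (inj₂ (p , j≡0)) (inj₂ (q , i≡0)) rewrite i≡0 | sym p = case 3≤n
  where case : ¬ 3 ℕ.≤ 1
        case (s≤s ())

cycle-neighbours : ∀ {3≤n : 3 ℕ.≤ n} {h i j : Fin n} → CyclicSucc i j → CyclicSucc h i →
                   NeighbourList (cycleGraph n 3≤n) i (j ∷ h ∷ [])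
cycle-neighbours {3≤n = 3≤n} {h} {i} {j} i→j h→i = twoNeighbours j≢h only (inj₁ i→j) (inj₂ h→i)
  where
  j≢h : j ≢ h
  j≢h refl = successor-asym 3≤n i→j h→i

  only : ∀ {z} → CycleAdj i z → z ≡ j ⊎ z ≡ h
  only (inj₁ i→z) = inj₁ (successor-unique i→z i→j)
  only (inj₂ z→i) = inj₂ (predecessor-unique z→i h→i)

cycle-degree : ∀ {3≤n : 3 ℕ.≤ n} v → degree (cycleGraph n 3≤n) v ≡ 2
cycle-degree {3≤n = 3≤n} v = degree-length
  (cycle-neighbours {3≤n = 3≤n} (proj₂ (successor v)) (proj₂ (predecessor v)))

-- Disjoint unions

-- An isomorphism of G onto a union of connected components of H.
record Component (G H : Graph) : Set where
  field
    φ         : Vertex G → Vertex H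
    injective : ∀ {u v} → φ u ≡ φ v → u ≡ v
    preserves : ∀ {u v} → Adj G u v → Adj H (φ u) (φ v)
    closed    : ∀ {u v} → Adj H (φ u) v → ∃ λ w → v ≡ φ w × Adj G u w

  reflects : ∀ {u v} → Adj H (φ u) (φ v) → Adj G u v
  reflects a with _ , v≡w , a′ ← closed a rewrite injective v≡w = a′

  map-neighbours : ∀ {u ns} → NeighbourList G u ns → NeighbourList H (φ u) (map φ ns)
  map-neighbours nl = record
    { unique = Unique.map⁺ injective (unique nl)
    ; adj⇒∈  = λ a → let _ , v≡ , a′ = closed a in
                 subst (_∈ _) (sym v≡) (∈-map⁺ φ (adj⇒∈ nl a′))
    ; ∈⇒adj  = λ v∈ → let _ , w∈ , v≡ = ∈-map⁻ φ v∈ in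
                 subst (Adj H _) (sym v≡) (preserves (∈⇒adj nl w∈))
    }

  degree-φ : ∀ u → degree H (φ u) ≡ degree G u
  degree-φ u = trans (degree-length (map-neighbours neighbours-list))
                     (List.length-map φ (neighbours G u))

infixr 9 _∘ᶜ_

_∘ᶜ_ : ∀ {K} → Component H K → Component G H → Component G K
κ ∘ᶜ ι = record
  { φ         = κ.φ ∘ ι.φ
  ; injective = ι.injective ∘ κ.injective
  ; preserves = κ.preserves ∘ ι.preserves
  ; closed    = λ a → let v , p , a′ = κ.closed a
                          w , q , a″ = ι.closed a′
                      in w , trans p (cong κ.φ q) , a″
  }
  where
  module κ = Component κ
  module ι = Component ι

module _ {G H : Graph} where

  inj₁-adj : ∀ {u v} → Adj G u v → Adj (G ⊕ H) (u ↑ˡ order H) (v ↑ˡ order H)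
  inj₁-adj {u} {v} a
    rewrite Fin.splitAt-↑ˡ (order G) u (order H) | Fin.splitAt-↑ˡ (order G) v (order H)
    = Pointwise.inj₁ a

  inj₂-adj : ∀ {u v} → Adj H u v → Adj (G ⊕ H) (order G ↑ʳ u) (order G ↑ʳ v)
  inj₂-adj {u} {v} a
    rewrite Fin.splitAt-↑ʳ (order G) (order H) u | Fin.splitAt-↑ʳ (order G) (order H) v
    = Pointwise.inj₂ a

  adj-inj₁ : ∀ {u v} → Adj (G ⊕ H) (u ↑ˡ order H) v → ∃ λ w → v ≡ w ↑ˡ order H × Adj G u w
  adj-inj₁ {u} {v} a
    with splitAt (order G) v in eq
  ... | inj₁ w rewrite Fin.splitAt-↑ˡ (order G) u (order H) with a
  ...   | Pointwise.inj₁ a′ = w , sym (Fin.splitAt⁻¹-↑ˡ eq) , a′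
  adj-inj₁ {u} {v} a | inj₂ w rewrite Fin.splitAt-↑ˡ (order G) u (order H) with () ← a

  adj-inj₂ : ∀ {u v} → Adj (G ⊕ H) (order G ↑ʳ u) v → ∃ λ w → v ≡ order G ↑ʳ w × Adj H u w
  adj-inj₂ {u} {v} a
    with splitAt (order G) v in eq
  ... | inj₂ w rewrite Fin.splitAt-↑ʳ (order G) (order H) u with a
  ...   | Pointwise.inj₂ a′ = w , sym (Fin.splitAt⁻¹-↑ʳ eq) , a′
  adj-inj₂ {u} {v} a | inj₁ w rewrite Fin.splitAt-↑ʳ (order G) (order H) u with () ← a

  left : Component G (G ⊕ H)
  left = record
    { φ         = _↑ˡ order H
    ; injective = Fin.↑ˡ-injective (order H) _ _
    ; preserves = inj₁-adj
    ; closed    = adj-inj₁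
    }

  right : Component H (G ⊕ H)
  right = record
    { φ         = order G ↑ʳ_
    ; injective = Fin.↑ʳ-injective (order G) _ _
    ; preserves = inj₂-adj
    ; closed    = adj-inj₂
    }

  ⊕-elim : ∀ {p} (P : Vertex (G ⊕ H) → Set p) → (∀ u → P (u ↑ˡ order H)) →
           (∀ u → P (order G ↑ʳ u)) → ∀ v → P v
  ⊕-elim P l r v with splitAt (order G) v in eq
  ... | inj₁ u = subst P (Fin.splitAt⁻¹-↑ˡ eq) (l u)
  ... | inj₂ u = subst P (Fin.splitAt⁻¹-↑ʳ eq) (r u)

-- Bipartitions and degree sequences

_⊕ᴮ_ : Bipartition G → Bipartition H → Bipartition (G ⊕ H)
_⊕ᴮ_ {G} {H} B C = record
  { side     = [ side B , side C ]′ ∘ splitAt (order G)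
  ; crossing = λ {u} {v} → cross (splitAt (order G) u) (splitAt (order G) v)
  }
  where
  cross : ∀ x y → Pointwise (Adj G) (Adj H) x y →
          [ side B , side C ]′ x ≢ [ side B , side C ]′ y
  cross _ _ (Pointwise.inj₁ a) = crossing B a
  cross _ _ (Pointwise.inj₂ a) = crossing C a

module _ {B : Bipartition G} {C : Bipartition H} where

  inj₁-side : ∀ u → side (B ⊕ᴮ C) (u ↑ˡ order H) ≡ side B u
  inj₁-side u = cong [ side B , side C ]′ (Fin.splitAt-↑ˡ (order G) u (order H))

  inj₂-side : ∀ u → side (B ⊕ᴮ C) (order G ↑ʳ u) ≡ side C u
  inj₂-side u = cong [ side B , side C ]′ (Fin.splitAt-↑ʳ (order G) (order H) u)

SideOfDegree : Bipartition G → Bool → ℕ → Set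
SideOfDegree {G} B s d = ∀ v → side B v ≡ s → degree G v ≡ d

⊕-sideOfDegree : ∀ {B : Bipartition G} {C : Bipartition H} {s d} →
                 SideOfDegree B s d → SideOfDegree C s d → SideOfDegree (B ⊕ᴮ C) s d
⊕-sideOfDegree {G} {H} {B} {C} regB regC = ⊕-elim {G} {H} _
  (λ u s → trans (Component.degree-φ (left {G} {H}) u)
                 (regB u (trans (sym (inj₁-side {B = B} {C} u)) s)))
  (λ u s → trans (Component.degree-φ (right {G} {H}) u)
                 (regC u (trans (sym (inj₂-side {B = B} {C} u)) s)))

-- An edge has an end on each side of every bipartition. If its ends have equal degrees,
-- bi-regularity would force this degree on all vertices, on whichever side `w` lies.
¬biRegular : ∀ {u v w : Vertex G} → Adj G u v → degree G u ≡ degree G v →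
             degree G w ≢ degree G u → ¬ BiRegular G
¬biRegular {G} {u} {v} {w} a u≡v w≢u (B , regular) with side B w Bool.≟ side B u
... | yes same = let _ , reg = regular (side B u) in
                 w≢u (trans (reg w same) (sym (reg u refl)))
... | no differ = let _ , reg = regular (side B v) in
                  w≢u (trans (trans (reg w same) (sym (reg v refl))) (sym u≡v))
  where
  same : side B w ≡ side B v
  same = trans (Bool.¬-not differ) (sym (Bool.¬-not (crossing B (Graph.sym G a))))

-- Parity bipartitions and the degree lists of paths and cycles

even : ℕ → Bool
even 0             = true
even 1             = false
even (suc (suc n)) = even n

even-suc : ∀ n → even (suc n) ≡ not (even n)
even-suc 0             = refl
even-suc 1             = refl
even-suc (suc (suc n)) = even-suc n

even-suc-≢ : ∀ {k l} → l ≡ suc k → even k ≢ even l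
even-suc-≢ {k} refl eq = Bool.not-¬ refl (trans eq (even-suc k))

pathBipartition : ∀ ℓ → Bipartition (pathGraph ℓ)
pathBipartition ℓ = record
  { side     = even ∘ toℕ
  ; crossing = λ { (inj₁ p) → even-suc-≢ p ; (inj₂ p) → even-suc-≢ p ∘ sym }
  }

cycleBipartition : ∀ {3≤n} → even n ≡ true → Bipartition (cycleGraph n 3≤n)
cycleBipartition {n} n-even = record
  { side     = even ∘ toℕ
  ; crossing = λ { (inj₁ s) → cross s ; (inj₂ s) → cross s ∘ sym }
  }
  where
  cross : ∀ {i j : Fin n} → CyclicSucc i j → even (toℕ i) ≢ even (toℕ j)
  cross (inj₁ p)         = even-suc-≢ p
  cross {i} (inj₂ (p , q)) rewrite q =
    λ eq → even-suc-≢ (sym p) (trans eq (sym n-even))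

-- The unsorted list behind `degreeSequence`, as a recursion on `Fin n`: it splits along disjoint
-- unions and unfolds two positions at a time, in step with `even`.
select : Bool → (e : Fin n → Bool) (d : Fin n → ℕ) → List ℕ
select {zero}  s e d = []
select {suc n} s e d =
  (if does (e zero Bool.≟ s) then d zero ∷_ else id) (select s (e ∘ suc) (d ∘ suc))

select-correct : ∀ {A : Set} s (e : A → Bool) (d : A → ℕ) (f : Fin n → A) →
  map d (filter (λ v → e v Bool.≟ s) (tabulate f)) ≡ select s (e ∘ f) (d ∘ f)
select-correct {zero}  s e d f = refl
select-correct {suc n} s e d f with does (e (f zero) Bool.≟ s)
... | true  = cong (d (f zero) ∷_) (select-correct s e d (f ∘ suc))
... | false = select-correct s e d (f ∘ suc)

select-cong : ∀ s {e e′ : Fin n → Bool} {d d′ : Fin n → ℕ} →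
              (∀ v → e v ≡ e′ v) → (∀ v → d v ≡ d′ v) → select s e d ≡ select s e′ d′
select-cong {zero}  s p q = refl
select-cong {suc n} s p q
  rewrite p zero | q zero | select-cong s (p ∘ suc) (q ∘ suc) = refl

select-++ : ∀ s (e : Fin (m ℕ.+ n) → Bool) d →
            select s e d ≡ select s (e ∘ (_↑ˡ n)) (d ∘ (_↑ˡ n))
                        ++ select s (e ∘ (m ↑ʳ_)) (d ∘ (m ↑ʳ_))
select-++ {zero}  s e d = refl
select-++ {suc m} s e d with does (e zero Bool.≟ s)
... | true  = cong (d zero ∷_) (select-++ {m} s (e ∘ suc) (d ∘ suc))
... | false = select-++ {m} s (e ∘ suc) (d ∘ suc)

replicate-+ : ∀ {A : Set} m {x : A} → replicate (m ℕ.+ n) x ≡ replicate m x ++ replicate n x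
replicate-+ zero    = refl
replicate-+ (suc m) = cong (_ ∷_) (replicate-+ m)

-- Sorting forgets the order, so a side on which only the degrees 1 and 2 occur is described by two
-- counts, which add up over disjoint unions.
record OnesAndTwos {G} (B : Bipartition G) (s : Bool) (a b : ℕ) : Set where
  constructor onesAndTwos
  field
    permutation : select s (side B) (degree G) ↭ replicate a 1 ++ replicate b 2

⊕-onesAndTwos : ∀ {B : Bipartition G} {C : Bipartition H} {s a b a′ b′} →
                OnesAndTwos B s a b → OnesAndTwos C s a′ b′ →
                OnesAndTwos (B ⊕ᴮ C) s (a ℕ.+ a′) (b ℕ.+ b′)
⊕-onesAndTwos {G} {H} {B} {C} {s} {a} {b} {a′} {b′} (onesAndTwos p) (onesAndTwos q) =
  onesAndTwos (begin
  select s (side (B ⊕ᴮ C)) (degree (G ⊕ H))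
    ≡⟨ select-++ {order G} s (side (B ⊕ᴮ C)) (degree (G ⊕ H)) ⟩
  select s (side (B ⊕ᴮ C) ∘ (_↑ˡ order H)) (degree (G ⊕ H) ∘ (_↑ˡ order H)) ++
  select s (side (B ⊕ᴮ C) ∘ (order G ↑ʳ_)) (degree (G ⊕ H) ∘ (order G ↑ʳ_))
    ≡⟨ cong₂ _++_ (select-cong s (inj₁-side {B = B} {C}) (Component.degree-φ (left {G} {H})))
                  (select-cong s (inj₂-side {B = B} {C}) (Component.degree-φ (right {G} {H}))) ⟩
  select s (side B) (degree G) ++ select s (side C) (degree H)
    ↭⟨ Perm.++⁺ p q ⟩
  (replicate a 1 ++ replicate b 2) ++ (replicate a′ 1 ++ replicate b′ 2)
    ≡⟨ List.++-assoc (replicate a 1) _ _ ⟩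
  replicate a 1 ++ replicate b 2 ++ replicate a′ 1 ++ replicate b′ 2
    ↭⟨ Perm.++⁺ˡ (replicate a 1) (Perm.shifts (replicate b 2) (replicate a′ 1)) ⟩
  replicate a 1 ++ replicate a′ 1 ++ replicate b 2 ++ replicate b′ 2
    ≡⟨ List.++-assoc (replicate a 1) _ _ ⟨
  (replicate a 1 ++ replicate a′ 1) ++ (replicate b 2 ++ replicate b′ 2)
    ≡⟨ cong₂ _++_ (replicate-+ a) (replicate-+ b) ⟨
  replicate (a ℕ.+ a′) 1 ++ replicate (b ℕ.+ b′) 2 ∎)
  where open Perm.PermutationReasoning

degreeSequence-≡ : ∀ {B : Bipartition G} {C : Bipartition H} {s a b} →
                   OnesAndTwos B s a b → OnesAndTwos C s a b →
                   degreeSequence B s ≡ degreeSequence C s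
degreeSequence-≡ {G} {H} {B} {C} {s} (onesAndTwos p) (onesAndTwos q) =
  Pointwise-≡⇒≡ (↗↭↗⇒≋ (DecTotalOrder.totalOrder ≥-order) (sort-↗ _) (sort-↗ _) (↭⇒↭ₛ
    (↭-trans (sort-↭ _) (↭-trans same (↭-sym (sort-↭ _))))))
  where
  ≥-order = Flip.decTotalOrder ℕ.≤-decTotalOrder
  open Sort ≥-order

  same = ↭-trans (↭-reflexive (select-correct s (side B) (degree G) id))
        (↭-trans p (↭-trans (↭-sym q)
        (↭-sym (↭-reflexive (select-correct s (side C) (degree H) id)))))

-- Of two consecutive positions exactly one lies on side `s`.
select-twos : ∀ s (d : Fin n → ℕ) → (∀ v → d v ≡ 2) → n ≡ m ℕ.* 2 →
              select s (even ∘ toℕ) d ≡ replicate m 2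
select-twos {m = zero}  s     d all≡2 refl = refl
select-twos {m = suc m} true  d all≡2 refl =
  cong₂ _∷_ (all≡2 zero) (select-twos true _ (λ v → all≡2 (suc (suc v))) refl)
select-twos {m = suc m} false d all≡2 refl =
  cong₂ _∷_ (all≡2 (suc zero)) (select-twos false _ (λ v → all≡2 (suc (suc v))) refl)

cycle-onesAndTwos : ∀ {3≤n} {n-even : even n ≡ true} s → n ≡ m ℕ.* 2 →
                    OnesAndTwos (cycleBipartition {n} {3≤n} n-even) s 0 m
cycle-onesAndTwos {3≤n = 3≤n} s n≡m*2 =
  onesAndTwos (↭-reflexive (select-twos s _ (cycle-degree {3≤n = 3≤n}) n≡m*2))

path-end-degree : ∀ {ℓ} (i : Vertex (pathGraph (suc ℓ))) → toℕ i ≡ 0 ⊎ toℕ i ≡ suc ℓ →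
                  degree (pathGraph (suc ℓ)) i ≡ 1
path-end-degree i       (inj₁ i≡0) =
  degree-length (path-first {i = i} {j = suc zero} i≡0 refl)
path-end-degree (suc i) (inj₂ i≡ℓ) =
  degree-length (path-last {h = inject₁ i} i≡ℓ (cong suc (sym (Fin.toℕ-inject₁ i))))

path-inner-degree : ∀ {ℓ} (i : Vertex (pathGraph ℓ)) → toℕ i ≢ 0 → toℕ i ≢ ℓ →
                    degree (pathGraph ℓ) i ≡ 2
path-inner-degree zero    i≢0 _ = contradiction refl i≢0
path-inner-degree {ℓ} (suc i) _ i≢ℓ = degree-length (path-inner {h = inject₁ i}
  (Fin.toℕ-fromℕ< (s≤s (ℕ.≤∧≢⇒< (Fin.toℕ≤pred[n] (suc i)) i≢ℓ)))
  (cong suc (sym (Fin.toℕ-inject₁ i))))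

-- Meant for a path without its first two vertices: parities are unchanged and the last vertex is
-- the only one left of degree 1.
select-true-last : ∀ k (d : Fin (suc (k ℕ.* 2)) → ℕ) →
  (∀ v → toℕ v ≢ k ℕ.* 2 → d v ≡ 2) → (∀ v → toℕ v ≡ k ℕ.* 2 → d v ≡ 1) →
  select true (even ∘ toℕ) d ≡ replicate k 2 ++ (1 ∷ [])
select-true-last zero    d twos one = cong (_∷ []) (one zero refl)
select-true-last (suc k) d twos one = cong₂ _∷_ (twos zero λ ())
  (select-true-last k (λ v → d (suc (suc v)))
    (λ v v≢ → twos (suc (suc v)) (v≢ ∘ ℕ.suc-injective ∘ ℕ.suc-injective))
    (λ v v≡ → one (suc (suc v)) (cong (2 ℕ.+_) v≡)))

select-false-odd : ∀ k (d : Fin (suc (k ℕ.* 2)) → ℕ) → 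
  (∀ v → even (toℕ v) ≡ false → d v ≡ 2) → select false (even ∘ toℕ) d ≡ replicate k 2
select-false-odd zero    d twos = refl
select-false-odd (suc k) d twos = cong₂ _∷_ (twos (suc zero) refl)
  (select-false-odd k (λ v → d (suc (suc v))) (λ v → twos (suc (suc v))))

even-double : ∀ k → even (k ℕ.* 2) ≡ true
even-double zero    = refl
even-double (suc k) = even-double k

-- The ends are at positions 0 and `k * 2`, both even, so odd positions are inner.
path-odd-side : ∀ k → SideOfDegree (pathBipartition (k ℕ.* 2)) false 2
path-odd-side k v odd = path-inner-degree v (λ v≡0 → case (trans (sym odd) (cong even v≡0)))
  (λ v≡ → case (trans (sym odd) (trans (cong even v≡) (even-double k))))
  where case : false ≢ true
        case ()

path-onesAndTwos : ∀ k {ℓ} → ℓ ≡ suc k ℕ.* 2 →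
                   OnesAndTwos (pathBipartition ℓ) true 2 k ×
                   OnesAndTwos (pathBipartition ℓ) false 0 (suc k)
path-onesAndTwos k refl =
  onesAndTwos evens , onesAndTwos (↭-reflexive (select-false-odd (suc k) d (path-odd-side (suc k))))
  where
  open Perm.PermutationReasoning
  d = degree (pathGraph (suc k ℕ.* 2))
  d′ : Fin (suc (k ℕ.* 2)) → ℕ
  d′ v = d (suc (suc v))

  evens : select true (even ∘ toℕ) d ↭ 1 ∷ 1 ∷ replicate k 2
  evens = begin
    d zero ∷ select true (even ∘ toℕ) d′
      ≡⟨ cong₂ _∷_ (path-end-degree {suc (k ℕ.* 2)} zero (inj₁ refl)) (select-true-last k d′
           (λ v v≢ → path-inner-degree (suc (suc v)) (λ ()) (v≢ ∘ ℕ.suc-injective ∘ ℕ.suc-injective))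
           (λ v v≡ → path-end-degree (suc (suc v)) (inj₂ (cong (2 ℕ.+_) v≡)))) ⟩
    1 ∷ replicate k 2 ++ (1 ∷ [])
      ↭⟨ ↭-prep 1 (Perm.++-comm (replicate k 2) (1 ∷ [])) ⟩
    1 ∷ 1 ∷ replicate k 2 ∎

-- Cycles as subgraphs

open Cycle using (node; injective; adjacent; Edge)

infix 4 _≋_

_≋_ : Cycle G n → Cycle G n → Set
C ≋ D = ∀ u v → Edge C u v ⇔ Edge D u v

nodes-≋ : (C D : Cycle G n) → (∀ i → node C i ≡ node D i) → C ≋ D
nodes-≋ C D C≡D u v = mk⇔
  (λ (i , j , a , p , q) → i , j , a , trans (sym (C≡D i)) p , trans (sym (C≡D j)) q)
  (λ (i , j , a , p , q) → i , j , a , trans (C≡D i) p , trans (C≡D j) q)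

has-edge : (C : Cycle G n) → ∃₂ (Edge C)
has-edge C with s≤s (s≤s _) ← Cycle.3≤g C = _ , _ , zero , suc zero , inj₁ (inj₁ refl) , refl , refl

-- Connectedness of the cycle, as an induction principle: the property is carried from `i` down to
-- `zero` and from there up to `j`.
around : ∀ {p} (P : Fin n → Set p) → (∀ {i j} → CycleAdj i j → P i → P j) →
         ∀ {i} → P i → ∀ j → P j
around {zero}  P step {()}
around {suc n} P step Pi = <-weakInduction P (down _ Pi) (λ j → step (next j))
  where
  next : ∀ (j : Fin n) → CycleAdj (inject₁ j) (suc j)
  next j = inj₁ (inj₁ (cong suc (sym (Fin.toℕ-inject₁ j))))

  down : ∀ j → P j → P zero
  down = <-weakInduction (λ j → P j → P zero) id (λ j f → f ∘ step (Sum.swap (next j)))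

-- Cycles in components and disjoint unions

module _ (ι : Component G H) where
  open Component ι renaming (injective to φ-injective)

  embed : Cycle G n → Cycle H n
  embed C = record
    { 3≤g       = Cycle.3≤g C
    ; node      = φ ∘ node C
    ; injective = injective C ∘ φ-injective
    ; adjacent  = preserves ∘ adjacent C
    }

  embed-edge : (C : Cycle G n) → ∀ {u v} → Edge C u v → Edge (embed C) (φ u) (φ v)
  embed-edge C (i , j , a , p , q) = i , j , a , cong φ p , cong φ q

  embed-edge⁻ : (C : Cycle G n) → ∀ {u v} → Edge (embed C) (φ u) (φ v) → Edge C u v
  embed-edge⁻ C (i , j , a , p , q) = i , j , a , φ-injective p , φ-injective q

  embed-cong : (C D : Cycle G n) → C ≋ D → embed C ≋ embed D
  embed-cong C D C≋D _ _ = mk⇔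
    (λ { (i , j , a , refl , refl) → embed-edge D
         (Equivalence.to   (C≋D _ _) (i , j , a , refl , refl)) })
    (λ { (i , j , a , refl , refl) → embed-edge C
         (Equivalence.from (C≋D _ _) (i , j , a , refl , refl)) })

  embed-injective : (C D : Cycle G n) → embed C ≋ embed D → C ≋ D
  embed-injective C D C≋D u v = mk⇔
    (embed-edge⁻ D ∘ Equivalence.to   (C≋D _ _) ∘ embed-edge C)
    (embed-edge⁻ C ∘ Equivalence.from (C≋D _ _) ∘ embed-edge D)

  -- A cycle is connected and a component is closed under adjacency, so a single common vertex puts
  -- the whole cycle into the component.
  restrict : (C : Cycle H n) → ∀ {i u} → node C i ≡ φ u → ∃ λ D → embed D ≋ C
  restrict C i≡u = D , nodes-≋ (embed D) C (sym ∘ proj₂ ∘ preimage)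
    where
    step : ∀ {i j} → CycleAdj i j → (∃ λ w → node C i ≡ φ w) → ∃ λ w → node C j ≡ φ w
    step {j = j} a (_ , p)
      with w , q , _ ← closed (subst (λ v → Adj H v (node C j)) p (adjacent C a)) = w , q

    preimage : ∀ j → ∃ λ w → node C j ≡ φ w
    preimage = around _ step (_ , i≡u)

    D : Cycle G _
    D = record
      { 3≤g       = Cycle.3≤g C
      ; node      = proj₁ ∘ preimage
      ; injective = λ {i} {j} eq → injective C
          (trans (proj₂ (preimage i)) (trans (cong φ eq) (sym (proj₂ (preimage j)))))
      ; adjacent  = λ {i} {j} a → reflects
          (subst₂ (Adj H) (proj₂ (preimage i)) (proj₂ (preimage j)) (adjacent C a))
      }

module _ {G H : Graph} where

  inlᶜ : Cycle G n → Cycle (G ⊕ H) n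
  inlᶜ = embed (left {G} {H})

  inrᶜ : Cycle H n → Cycle (G ⊕ H) n
  inrᶜ = embed (right {G} {H})

  ↑ˡ≢↑ʳ : ∀ {u : Vertex G} {v : Vertex H} → u ↑ˡ order H ≢ order G ↑ʳ v
  ↑ˡ≢↑ʳ {u} {v} eq with trans (sym (Fin.splitAt-↑ˡ (order G) u (order H)))
                       (trans (cong (splitAt (order G)) eq) (Fin.splitAt-↑ʳ (order G) (order H) v))
  ... | ()

  inlᶜ≉inrᶜ : (C : Cycle G n) (D : Cycle H n) → ¬ (inlᶜ C ≋ inrᶜ D)
  inlᶜ≉inrᶜ C D C≋D =
    let _ , _ , e = has-edge (inlᶜ C)
        _ , _ , _ , p , _ = e
        _ , _ , _ , q , _ = Equivalence.to (C≋D _ _) e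
    in ↑ˡ≢↑ʳ (trans p (sym q))

  split : (C : Cycle (G ⊕ H) n) → (∃ λ D → inlᶜ D ≋ C) ⊎ (∃ λ D → inrᶜ D ≋ C)
  split C with s≤s _ ← Cycle.3≤g C =
    ⊕-elim {G} {H} (λ v → node C zero ≡ v → (∃ λ D → inlᶜ D ≋ C) ⊎ (∃ λ D → inrᶜ D ≋ C))
      (λ _ → inj₁ ∘ restrict (left {G} {H}) C) (λ _ → inj₂ ∘ restrict (right {G} {H}) C) _ refl

noCycles⇒0 : ∀ {g} → ¬ Cycle G g → NumberOfCycles G g 0
noCycles⇒0 none = record
  { to        = λ ()
  ; cong      = λ { {()} }
  ; bijective = (λ { {()} }) , λ C → contradiction C none
  }

⊕-numberOfCycles : ∀ {g M N} → NumberOfCycles G g M → NumberOfCycles H g N →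
                   NumberOfCycles (G ⊕ H) g (M ℕ.+ N)
⊕-numberOfCycles {G} {H} {g} {M} {N} countG countH = record
  { to        = toˢ ∘ splitAt M
  ; cong      = λ { {x} refl → ≋.refl {toˢ (splitAt M x)} }
  ; bijective = to-injective , to-surjective
  }
  where
  module G = Bijection countG
  module H = Bijection countH
  module ≋ = Setoid (cycleSetoid (G ⊕ H) g)

  toˢ : Fin M ⊎ Fin N → Cycle (G ⊕ H) g
  toˢ = [ inlᶜ {G} {H} ∘ G.to , inrᶜ {G} {H} ∘ H.to ]′

  toˢ-injective : ∀ x y → toˢ x ≋ toˢ y → x ≡ y
  toˢ-injective (inj₁ i) (inj₁ j) eq =
    cong inj₁ (G.injective (embed-injective (left {G} {H}) (G.to i) (G.to j) eq))
  toˢ-injective (inj₁ i) (inj₂ j) eq =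
    contradiction eq (inlᶜ≉inrᶜ {G} {H} (G.to i) (H.to j))
  toˢ-injective (inj₂ i) (inj₁ j) eq =
    contradiction (≋.sym {toˢ (inj₂ i)} {toˢ (inj₁ j)} eq) (inlᶜ≉inrᶜ {G} {H} (G.to j) (H.to i))
  toˢ-injective (inj₂ i) (inj₂ j) eq =
    cong inj₂ (H.injective (embed-injective (right {G} {H}) (H.to i) (H.to j) eq))

  to-injective : ∀ {x y} → toˢ (splitAt M x) ≋ toˢ (splitAt M y) → x ≡ y
  to-injective {x} {y} eq = trans (sym (Fin.join-splitAt M N x))
    (trans (cong (Fin.join M N) (toˢ-injective (splitAt M x) (splitAt M y) eq))
           (Fin.join-splitAt M N y))

  toˢ-surjective : ∀ C → ∃ λ x → toˢ x ≋ C
  toˢ-surjective C with split {G} {H} C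
  ... | inj₁ (D , D≋C) = let i , i↦D = G.surjective D in
    inj₁ i , ≋.trans {toˢ (inj₁ i)} {inlᶜ {G} {H} D} {C}
               (embed-cong (left {G} {H}) (G.to i) D (i↦D refl)) D≋C
  ... | inj₂ (D , D≋C) = let i , i↦D = H.surjective D in
    inj₂ i , ≋.trans {toˢ (inj₂ i)} {inrᶜ {G} {H} D} {C}
               (embed-cong (right {G} {H}) (H.to i) D (i↦D refl)) D≋C

  to-surjective : ∀ C → ∃ λ x → ∀ {z} → z ≡ x → toˢ (splitAt M z) ≋ C
  to-surjective C with x , x↦C ← toˢ-surjective C =
    Fin.join M N x , λ { refl → subst (λ y → toˢ y ≋ C) (sym (Fin.splitAt-join M N x)) x↦C }

⊕-girth-≥ : ∀ {g} → (∀ m → Cycle G m → g ℕ.≤ m) → (∀ m → Cycle H m → g ℕ.≤ m) →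
            ∀ m → Cycle (G ⊕ H) m → g ℕ.≤ m
⊕-girth-≥ {G} {H} boundG boundH m C =
  [ boundG m ∘ proj₁ , boundH m ∘ proj₁ ]′ (split {G} {H} C)

-- Cycles in paths and in cycle graphs

node-neighbours : (C : Cycle G n) → ∀ i → ∃₂ λ j h →
                  CycleAdj i j × CycleAdj i h × node C j ≢ node C h
node-neighbours C i =
  let j , i→j = successor i
      h , h→i = predecessor i
  in j , h , inj₁ i→j , inj₂ h→i , λ eq → 
     successor-asym (Cycle.3≤g C) i→j (subst (λ k → CyclicSucc k i) (sym (injective C eq)) h→i)

-- By induction on the position k along the path: the two neighbours of a node
-- at position k would both be at position suc k.
path-acyclic : ∀ {ℓ} → ¬ Cycle (pathGraph ℓ) n
path-acyclic {n} {ℓ} C with s≤s _ ← Cycle.3≤g C = absent _ zero refl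
  where
  absent : ∀ k i → toℕ (node C i) ≢ k
  next   : ∀ k i {j} → toℕ (node C i) ≡ k → CycleAdj i j → toℕ (node C j) ≡ suc k

  absent k i i≡k = let _ , _ , a , b , j≢h = node-neighbours C i in
    j≢h (Fin.toℕ-injective (trans (next k i i≡k a) (sym (next k i i≡k b))))

  next k       i     i≡k a with adjacent C a
  next k       i     i≡k a | inj₁ p = trans p (cong suc i≡k)
  next zero    i     i≡k a | inj₂ p = contradiction (trans (sym i≡k) p) λ ()
  next (suc k) i {j} i≡k a | inj₂ p =
    contradiction (ℕ.suc-injective (trans (sym p) i≡k)) (absent k j)

exhaust : ∀ {A : Set} {a b v w z : A} → a ≢ b → a ≡ v ⊎ a ≡ w → b ≡ v ⊎ b ≡ w →
          z ≡ v ⊎ z ≡ w → a ≡ z ⊎ b ≡ z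
exhaust a≢b (inj₁ refl) (inj₁ refl) _           = contradiction refl a≢b
exhaust a≢b (inj₂ refl) (inj₂ refl) _           = contradiction refl a≢b
exhaust a≢b (inj₁ refl) (inj₂ refl) (inj₁ refl) = inj₁ refl
exhaust a≢b (inj₁ refl) (inj₂ refl) (inj₂ refl) = inj₂ refl
exhaust a≢b (inj₂ refl) (inj₁ refl) (inj₁ refl) = inj₂ refl
exhaust a≢b (inj₂ refl) (inj₁ refl) (inj₂ refl) = inj₁ refl

module _ {3≤n : 3 ℕ.≤ n} (C : Cycle (cycleGraph n 3≤n) m) where

  adj⇒one-of-two : ∀ (u : Fin n) → ∃₂ λ v w → ∀ {z} → CycleAdj u z → z ≡ v ⊎ z ≡ w
  adj⇒one-of-two u = proj₁ (successor u) , proj₁ (predecessor u) , λ a →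
    case (adj⇒∈ (cycle-neighbours {3≤n = 3≤n} (proj₂ (successor u)) (proj₂ (predecessor u))) a)
    where
    case : ∀ {A : Set} {z v w : A} → z ∈ v ∷ w ∷ [] → z ≡ v ⊎ z ≡ w
    case (here p)         = inj₁ p
    case (there (here p)) = inj₂ p

  -- The vertex `node C i` has only two neighbours in the graph, and `C` already joins it to two
  -- distinct ones.
  node-edge : ∀ i {z} → CycleAdj (node C i) z → Edge C (node C i) z
  node-edge i a =
    let j , h , i~j , i~h , j≢h = node-neighbours C i
        _ , _ , only = adj⇒one-of-two (node C i)
    in [ (λ p → i , j , i~j , refl , p) , (λ p → i , h , i~h , refl , p) ]′
       (exhaust j≢h (only (adjacent C i~j)) (only (adjacent C i~h)) (only a))

  -- By `node-edge` the nodes of `C` are closed under adjacency, and the cycle graph is connected.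
  node-surjective : ∀ v → ∃ λ i → node C i ≡ v
  node-surjective with s≤s _ ← Cycle.3≤g C = around _
    (λ { a (i , refl) → let _ , j , _ , _ , p = node-edge i a in j , p }) (zero , refl)

  order≤length : n ℕ.≤ m
  order≤length = Fin.injective⇒≤ {f = proj₁ ∘ node-surjective} λ {u} {v} eq →
    trans (sym (proj₂ (node-surjective u))) (trans (cong (node C) eq) (proj₂ (node-surjective v)))

  adj⇒edge : ∀ {u v} → CycleAdj u v → Edge C u v
  adj⇒edge {u} a with i , refl ← node-surjective u = node-edge i a

edge⇒adj : (C : Cycle G n) → ∀ {u v} → Edge C u v → Adj G u v
edge⇒adj C (_ , _ , a , refl , refl) = adjacent C a

wholeCycle : ∀ {3≤n} → Cycle (cycleGraph n 3≤n) n
wholeCycle {3≤n = 3≤n} = record { 3≤g = 3≤n ; node = id ; injective = id ; adjacent = id }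

-- Any cycle in this graph uses all of its edges, by `adj⇒edge`, so all traversals give the same
-- subgraph.
cycle-numberOfCycles : ∀ {3≤n} → NumberOfCycles (cycleGraph n 3≤n) n 1
cycle-numberOfCycles {n} {3≤n} = record
  { to        = λ _ → whole
  ; cong      = λ _ → Setoid.refl (cycleSetoid (cycleGraph n 3≤n) n) {whole}
  ; bijective = (λ { {zero} {zero} _ → refl }) , λ C → zero , λ _ _ _ →
      mk⇔ (adj⇒edge {3≤n = 3≤n} C ∘ edge⇒adj whole) (adj⇒edge {3≤n = 3≤n} whole ∘ edge⇒adj C)
  }
  where whole = wholeCycle {n} {3≤n}

-- Two cycles and two paths of equal length

-- The common shape of `G₁ t` and `G₂ t`, which lets each property be proved once for both.
CyclesAndPaths : ∀ {n₁ n₂} → 3 ℕ.≤ n₁ → 3 ℕ.≤ n₂ → ℕ → Graph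
CyclesAndPaths {n₁} {n₂} 3≤n₁ 3≤n₂ ℓ =
  (cycleGraph n₁ 3≤n₁ ⊕ cycleGraph n₂ 3≤n₂) ⊕ (pathGraph ℓ ⊕ pathGraph ℓ)

CyclesAndPaths-acyclicPart : ∀ {ℓ} → ¬ Cycle (pathGraph ℓ ⊕ pathGraph ℓ) n
CyclesAndPaths-acyclicPart {ℓ = ℓ} C =
  [ path-acyclic ∘ proj₁ , path-acyclic ∘ proj₁ ]′ (split {pathGraph ℓ} {pathGraph ℓ} C)

module _ {n₁ n₂ ℓ : ℕ} (3≤n₁ : 3 ℕ.≤ n₁) (3≤n₂ : 3 ℕ.≤ n₂) where

  private
    C = cycleGraph n₁ 3≤n₁
    D = cycleGraph n₂ 3≤n₂
    P = pathGraph ℓ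
    Γ = CyclesAndPaths 3≤n₁ 3≤n₂ ℓ

  CyclesAndPaths-girth : n₁ ℕ.≤ n₂ → HasGirth Γ n₁
  CyclesAndPaths-girth n₁≤n₂ =
    inlᶜ {C ⊕ D} {P ⊕ P} (inlᶜ {C} {D} (wholeCycle {3≤n = 3≤n₁})) ,
    ⊕-girth-≥ {C ⊕ D} {P ⊕ P}
      (⊕-girth-≥ {C} {D} (λ _ → order≤length {3≤n = 3≤n₁})
                         (λ _ → ℕ.≤-trans n₁≤n₂ ∘ order≤length {3≤n = 3≤n₂}))
      (λ _ C → contradiction C CyclesAndPaths-acyclicPart)

  CyclesAndPaths-numberOfCycles : ∀ {g M N} → NumberOfCycles C g M → NumberOfCycles D g N →
                                  NumberOfCycles Γ g (M ℕ.+ N ℕ.+ 0)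
  CyclesAndPaths-numberOfCycles countC countD = ⊕-numberOfCycles
    (⊕-numberOfCycles countC countD) (noCycles⇒0 CyclesAndPaths-acyclicPart)

  module _ (m₁ m₂ j : ℕ) (n₁≡ : n₁ ≡ m₁ ℕ.* 2) (n₂≡ : n₂ ≡ m₂ ℕ.* 2)
           (ℓ≡ : ℓ ≡ suc j ℕ.* 2) where

    private
      even₁ : even n₁ ≡ true
      even₁ = trans (cong even n₁≡) (even-double m₁)
      even₂ : even n₂ ≡ true
      even₂ = trans (cong even n₂≡) (even-double m₂)
      BC = cycleBipartition {n₁} {3≤n₁} even₁
      BD = cycleBipartition {n₂} {3≤n₂} even₂
      BP = pathBipartition ℓ

    CyclesAndPaths-bipartition : Bipartition Γ
    CyclesAndPaths-bipartition = (BC ⊕ᴮ BD) ⊕ᴮ (BP ⊕ᴮ BP)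

    CyclesAndPaths-evens : OnesAndTwos CyclesAndPaths-bipartition true 4
                             ((m₁ ℕ.+ m₂) ℕ.+ (j ℕ.+ j))
    CyclesAndPaths-evens = ⊕-onesAndTwos
      (⊕-onesAndTwos (cycle-onesAndTwos {m = m₁} {3≤n₁} {even₁} true n₁≡)
                      (cycle-onesAndTwos {m = m₂} {3≤n₂} {even₂} true n₂≡))
      (⊕-onesAndTwos p p)
      where p = proj₁ (path-onesAndTwos j ℓ≡)

    CyclesAndPaths-odds : OnesAndTwos CyclesAndPaths-bipartition false 0
                            ((m₁ ℕ.+ m₂) ℕ.+ (suc j ℕ.+ suc j))
    CyclesAndPaths-odds = ⊕-onesAndTwos
      (⊕-onesAndTwos (cycle-onesAndTwos {m = m₁} {3≤n₁} {even₁} false n₁≡)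
                      (cycle-onesAndTwos {m = m₂} {3≤n₂} {even₂} false n₂≡))
      (⊕-onesAndTwos p p)
      where p = proj₂ (path-onesAndTwos j ℓ≡)

    CyclesAndPaths-halfRegular : HalfRegular Γ
    CyclesAndPaths-halfRegular =
      (CyclesAndPaths-bipartition , false , 2 ,
        ⊕-sideOfDegree {B = BC ⊕ᴮ BD} {BP ⊕ᴮ BP}
          (⊕-sideOfDegree {B = BC} {BD} (λ v _ → cycle-degree {3≤n = 3≤n₁} v)
                                        (λ v _ → cycle-degree {3≤n = 3≤n₂} v))
          (⊕-sideOfDegree {B = BP} {BP} odd odd)) ,
      -- Two adjacent vertices of the first cycle, both of degree 2, against an end of a path, of
      -- degree 1.
      ¬biRegular {Γ} {ιC.φ c} {ιC.φ c′} {ιP.φ (zero)}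
        (ιC.preserves (inj₁ (proj₂ (successor c))))
        (trans (degreeC c) (sym (degreeC c′)))
        λ eq → case (trans (sym degreeP) (trans eq (degreeC c)))
      where
      odd : SideOfDegree (pathBipartition ℓ) false 2
      odd = subst (λ ℓ → SideOfDegree (pathBipartition ℓ) false 2) (sym ℓ≡) (path-odd-side (suc j))

      ιC = left {C ⊕ D} {P ⊕ P} ∘ᶜ left {C} {D}
      ιP = right {C ⊕ D} {P ⊕ P} ∘ᶜ left {P} {P}
      module ιC = Component ιC
      module ιP = Component ιP

      c c′ : Vertex C
      c  = fromℕ< (ℕ.≤-trans (s≤s z≤n) 3≤n₁)
      c′ = proj₁ (successor c)

      degreeC : ∀ v → degree Γ (ιC.φ v) ≡ 2
      degreeC v = trans (ιC.degree-φ v) (cycle-degree {3≤n = 3≤n₁} v)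

      degreeP : degree Γ (ιP.φ zero) ≡ 1
      degreeP = trans (ιP.degree-φ zero) (end ℓ≡)
        where
        end : ∀ {ℓ} → ℓ ≡ suc j ℕ.* 2 → degree (pathGraph ℓ) zero ≡ 1
        end refl = path-end-degree {suc (j ℕ.* 2)} zero (inj₁ refl)

      case : 1 ≢ 2
      case ()

-- Ring identities with integer coefficients

-- Identities with the constants 2 and 4 need coefficients that can be compared and cancelled.
-- Equality in `R` need not be decidable, so integers serve as coefficients and are mapped into `R`.
module IntegerSolver {c ℓ : Level} (R : CommutativeRing c ℓ) where

  open CommutativeRing R renaming (refl to ≈-refl; sym to ≈-sym; trans to ≈-trans)
  open import Algebra.Properties.Ring ring using (-‿distribˡ-*; -‿distribʳ-*)
  open import Algebra.Properties.AbelianGroup +-abelianGroup using (⁻¹-∙-comm; ⁻¹-involutive; ε⁻¹≈ε)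
  open import Algebra.Properties.CommutativeSemigroup +-commutativeSemigroup using (interchange)
  open import Algebra.Properties.Semiring.Mult semiring using (×-homo-+; ×1-homo-*) renaming (_×_ to _×ᴺ_)
  open import Relation.Binary.Reasoning.Setoid setoid

  -- The pair (a , b) stands for the integer a - b.  The solver compares normal
  -- forms syntactically, so the operations return reduced pairs.
  ⟦_⟧ : ℕ × ℕ → Carrier
  ⟦ a , b ⟧ = a ×ᴺ 1# - b ×ᴺ 1#

  reduce : ℕ → ℕ → ℕ × ℕ
  reduce (suc a) (suc b) = reduce a b
  reduce a       b       = a , b

  reduce-correct : ∀ a b → let c , d = reduce a b in a ℕ.+ d ≡ c ℕ.+ b
  reduce-correct (suc a) (suc b) = trans (cong suc (reduce-correct a b)) (sym (ℕ.+-suc _ b))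
  reduce-correct zero    b       = refl
  reduce-correct (suc a) zero    = refl

  integers : RawRing _ _
  integers = record
    { Carrier = ℕ × ℕ
    ; _≈_     = _≡_
    ; _+_     = λ (a , b) (c , d) → reduce (a ℕ.+ c) (b ℕ.+ d)
    ; _*_     = λ (a , b) (c , d) → reduce (a ℕ.* c ℕ.+ b ℕ.* d) (a ℕ.* d ℕ.+ b ℕ.* c)
    ; -_      = λ (a , b) → b , a
    ; 0#      = 0 , 0
    ; 1#      = 1 , 0
    }

  neg-+ : ∀ x y → - (x + y) ≈ - x - y
  neg-+ x y = ≈-sym (⁻¹-∙-comm x y)

  neg-swap : ∀ x y → x - y ≈ - (y - x)
  neg-swap x y = ≈-trans (+-comm _ _)
    (≈-trans (+-congˡ (≈-sym (⁻¹-involutive _))) (≈-sym (neg-+ _ _)))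

  difference-+ : ∀ a b c d → (a + c) - (b + d) ≈ (a - b) + (c - d)
  difference-+ a b c d = ≈-trans (+-congˡ (neg-+ b d)) (interchange a c (- b) (- d))

  difference-* : ∀ a b c d → (a * c + b * d) - (a * d + b * c) ≈ (a - b) * (c - d)
  difference-* a b c d = begin
    (a * c + b * d) - (a * d + b * c)
      ≈⟨ difference-+ (a * c) (a * d) (b * d) (b * c) ⟩
    (a * c - a * d) + (b * d - b * c)
      ≈⟨ +-cong (minus a) (neg-swap _ _) ⟩
    a * (c - d) - (b * c - b * d)
      ≈⟨ +-congˡ (-‿cong (minus b)) ⟩
    a * (c - d) - b * (c - d)
      ≈⟨ +-congˡ (-‿distribˡ-* b (c - d)) ⟩
    a * (c - d) + - b * (c - d)
      ≈⟨ distribʳ (c - d) a (- b) ⟨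
    (a - b) * (c - d) ∎
    where
    minus : ∀ z → z * c - z * d ≈ z * (c - d)
    minus z = ≈-trans (+-congˡ (-‿distribʳ-* z d)) (≈-sym (distribˡ z c (- d)))

  ≈-difference : ∀ a b c d → a + d ≈ c + b → a - b ≈ c - d
  ≈-difference a b c d eq = begin
    a - b               ≈⟨ +-identityʳ (a - b) ⟨
    (a - b) + 0#        ≈⟨ +-congˡ (-‿inverseʳ d) ⟨
    (a - b) + (d - d)   ≈⟨ difference-+ a b d d ⟨
    (a + d) - (b + d)   ≈⟨ +-cong eq (-‿cong (+-comm b d)) ⟩
    (c + b) - (d + b)   ≈⟨ difference-+ c d b b ⟩
    (c - d) + (b - b)   ≈⟨ +-congˡ (-‿inverseʳ b) ⟩
    (c - d) + 0#        ≈⟨ +-identityʳ (c - d) ⟩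
    c - d               ∎

  ⟦⟧-cong : ∀ a b c d → a ℕ.+ d ≡ c ℕ.+ b → ⟦ a , b ⟧ ≈ ⟦ c , d ⟧
  ⟦⟧-cong a b c d eq = ≈-difference (a ×ᴺ 1#) (b ×ᴺ 1#) (c ×ᴺ 1#) (d ×ᴺ 1#) (begin
    a ×ᴺ 1# + d ×ᴺ 1#  ≈⟨ ×-homo-+ 1# a d ⟨
    (a ℕ.+ d) ×ᴺ 1#    ≡⟨ cong (_×ᴺ 1#) eq ⟩
    (c ℕ.+ b) ×ᴺ 1#    ≈⟨ ×-homo-+ 1# c b ⟩
    c ×ᴺ 1# + b ×ᴺ 1#  ∎)

  ⟦reduce⟧ : ∀ a b → ⟦ reduce a b ⟧ ≈ ⟦ a , b ⟧
  ⟦reduce⟧ a b = ≈-sym (⟦⟧-cong a b _ _ (reduce-correct a b))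

  morphism : integers -Raw-AlmostCommutative⟶ fromCommutativeRing R
  morphism = record
    { ⟦_⟧    = ⟦_⟧
    ; +-homo = λ (a , b) (c , d) → ≈-trans (⟦reduce⟧ (a ℕ.+ c) (b ℕ.+ d)) (≈-trans
        (+-cong (×-homo-+ 1# a c) (-‿cong (×-homo-+ 1# b d)))
        (difference-+ (a ×ᴺ 1#) (b ×ᴺ 1#) (c ×ᴺ 1#) (d ×ᴺ 1#)))
    ; *-homo = λ (a , b) (c , d) → ≈-trans
        (⟦reduce⟧ (a ℕ.* c ℕ.+ b ℕ.* d) (a ℕ.* d ℕ.+ b ℕ.* c)) (≈-trans
        (+-cong (products a c b d) (-‿cong (products a d b c)))
        (difference-* (a ×ᴺ 1#) (b ×ᴺ 1#) (c ×ᴺ 1#) (d ×ᴺ 1#)))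
    ; -‿homo = λ (a , b) → neg-swap (b ×ᴺ 1#) (a ×ᴺ 1#)
    ; 0-homo = -‿inverseʳ 0#
    ; 1-homo = ≈-trans (+-cong (+-identityʳ 1#) ε⁻¹≈ε) (+-identityʳ 1#)
    }
    where
    products : ∀ a c b d → (a ℕ.* c ℕ.+ b ℕ.* d) ×ᴺ 1# ≈
                           (a ×ᴺ 1#) * (c ×ᴺ 1#) + (b ×ᴺ 1#) * (d ×ᴺ 1#)
    products a c b d = ≈-trans (×-homo-+ 1# (a ℕ.* c) (b ℕ.* d)) (+-cong (×1-homo-* a c) (×1-homo-* b d))

  _≟_ : WeaklyDecidable (Induced-equivalence morphism)
  (a , b) ≟ (c , d) with a ℕ.+ d ℕ.≟ c ℕ.+ b
  ... | no  _  = nothing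
  ... | yes eq = just (⟦⟧-cong a b c d eq)

  open import Algebra.Solver.Ring integers (fromCommutativeRing R) morphism _≟_ public
    using (solve; _:+_; _:*_; _:-_; :-_; _:=_; con)

-- Linear isomorphisms between spaces of functions

module LinearAlgebra {c ℓ : Level} (R : CommutativeRing c ℓ) where

  open CommutativeRing R renaming (refl to ≈-refl; sym to ≈-sym; trans to ≈-trans; setoid to ≈-setoid)
  open IntegerSolver R
  open import Relation.Binary.Reasoning.Setoid ≈-setoid

  Subset : Set → Set (c ⊔ Level.suc ℓ)
  Subset I = (I → Carrier) → Set ℓ

  record IsLinear {I J : Set} (φ : (I → Carrier) → (J → Carrier)) : Set (c ⊔ ℓ) where
    field
      φ-cong : ∀ {f g} → (∀ i → f i ≈ g i) → ∀ j → φ f j ≈ φ g j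
      φ-+    : ∀ f g j → φ (λ i → f i + g i) j ≈ φ f j + φ g j
      φ-*    : ∀ a f j → φ (λ i → a * f i) j ≈ a * φ f j

  infix 4 _≅_

  -- The maps are linear on all functions but mutually inverse only on the subspaces. So restriction
  -- to one or two vertices can serve as `to`, and propagation by the recurrence as `from`.
  record _≅_ {I J : Set} (V : Subset I) (W : Subset J) : Set (c ⊔ ℓ) where
    field
      to          : (I → Carrier) → (J → Carrier)
      from        : (J → Carrier) → (I → Carrier)
      to-linear   : IsLinear to
      from-linear : IsLinear from
      to-∈        : ∀ {f} → V f → W (to f)
      from-∈      : ∀ {g} → W g → V (from g)
      from∘to     : ∀ {f} → V f → ∀ i → from (to f) i ≈ f i
      to∘from     : ∀ {g} → W g → ∀ j → to (from g) j ≈ g j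

    open IsLinear to-linear public
      using () renaming (φ-cong to to-cong; φ-+ to to-+; φ-* to to-*)
    open IsLinear from-linear public
      using () renaming (φ-cong to from-cong; φ-+ to from-+; φ-* to from-*)

  open _≅_

  private variable
    I J K L : Set
    V W X Y : Subset I

  ∘-linear : ∀ {φ : (I → Carrier) → (J → Carrier)} {ψ : (J → Carrier) → (K → Carrier)} →
             IsLinear ψ → IsLinear φ → IsLinear (ψ ∘ φ)
  ∘-linear {φ = φ} ψ-linear φ-linear = record
    { φ-cong = ψ.φ-cong ∘ φ.φ-cong
    ; φ-+    = λ f g k → ≈-trans (ψ.φ-cong (φ.φ-+ f g) k) (ψ.φ-+ (φ f) (φ g) k)
    ; φ-*    = λ a f k → ≈-trans (ψ.φ-cong (φ.φ-* a f) k) (ψ.φ-* a (φ f) k)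
    }
    where
    module φ = IsLinear φ-linear
    module ψ = IsLinear ψ-linear

  reindex-linear : (σ : J → I) → IsLinear (λ f → f ∘ σ)
  reindex-linear σ = record
    { φ-cong = λ f≈g j → f≈g (σ j)
    ; φ-+    = λ _ _ _ → ≈-refl
    ; φ-*    = λ _ _ _ → ≈-refl
    }

  reindex : (σ : J → I) (τ : I → J) → (∀ i → σ (τ i) ≡ i) → (∀ j → τ (σ j) ≡ j) →
            (∀ {f} → V f → W (f ∘ σ)) → (∀ {g} → W g → V (g ∘ τ)) → V ≅ W
  reindex σ τ στ τσ V⇒W W⇒V = record
    { to          = λ f → f ∘ σ
    ; from        = λ g → g ∘ τ
    ; to-linear   = reindex-linear σ
    ; from-linear = reindex-linear τ
    ; to-∈        = V⇒W
    ; from-∈      = W⇒V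
    ; from∘to     = λ {f} _ i → reflexive (cong f (στ i))
    ; to∘from     = λ {g} _ j → reflexive (cong g (τσ j))
    }

  ≅-sym : V ≅ W → W ≅ V
  ≅-sym e = record
    { to          = from e
    ; from        = to e
    ; to-linear   = from-linear e
    ; from-linear = to-linear e
    ; to-∈        = from-∈ e
    ; from-∈      = to-∈ e
    ; from∘to     = to∘from e
    ; to∘from     = from∘to e
    }

  ≅-trans : V ≅ W → W ≅ X → V ≅ X
  ≅-trans d e = record
    { to          = to e ∘ to d
    ; from        = from d ∘ from e
    ; to-linear   = ∘-linear (to-linear e) (to-linear d)
    ; from-linear = ∘-linear (from-linear d) (from-linear e)
    ; to-∈        = to-∈ e ∘ to-∈ d
    ; from-∈      = from-∈ d ∘ from-∈ e
    ; from∘to     = λ v i → ≈-trans (from-cong d (from∘to e (to-∈ d v)) i) (from∘to d v i)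
    ; to∘from     = λ x k → ≈-trans (to-cong e (to∘from d (from-∈ e x)) k) (to∘from e x k)
    }

  infixr 6 _⊞_

  _⊞_ : Subset I → Subset J → Subset (I ⊎ J)
  (V ⊞ W) f = V (f ∘ inj₁) × W (f ∘ inj₂)

  ⊞-linear : ∀ {φ : (I → Carrier) → (J → Carrier)} {ψ : (K → Carrier) → (L → Carrier)} →
             IsLinear φ → IsLinear ψ →
             IsLinear (λ (f : I ⊎ K → Carrier) → [ φ (f ∘ inj₁) , ψ (f ∘ inj₂) ])
  ⊞-linear φ-linear ψ-linear = record
    { φ-cong = λ f≈g → [ φ.φ-cong (f≈g ∘ inj₁) , ψ.φ-cong (f≈g ∘ inj₂) ]
    ; φ-+    = λ f g → [ φ.φ-+ (f ∘ inj₁) (g ∘ inj₁) , ψ.φ-+ (f ∘ inj₂) (g ∘ inj₂) ]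
    ; φ-*    = λ a f → [ φ.φ-* a (f ∘ inj₁) , ψ.φ-* a (f ∘ inj₂) ]
    }
    where
    module φ = IsLinear φ-linear
    module ψ = IsLinear ψ-linear

  ⊞-cong : V ≅ W → X ≅ Y → V ⊞ X ≅ W ⊞ Y
  ⊞-cong d e = record
    { to          = λ f → [ to d (f ∘ inj₁) , to e (f ∘ inj₂) ]
    ; from        = λ g → [ from d (g ∘ inj₁) , from e (g ∘ inj₂) ]
    ; to-linear   = ⊞-linear (to-linear d) (to-linear e)
    ; from-linear = ⊞-linear (from-linear d) (from-linear e)
    ; to-∈        = λ (v , x) → to-∈ d v , to-∈ e x
    ; from-∈      = λ (w , y) → from-∈ d w , from-∈ e y
    ; from∘to     = λ (v , x) → [ from∘to d v , from∘to e x ]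
    ; to∘from     = λ (w , y) → [ to∘from d w , to∘from e y ]
    }

  -- The exchange that relates the two graphs: `X` will be the two Dirichlet spaces of the second
  -- cycle and `Y` those of the two paths.
  ⊞-exchange : (V ⊞ (W ⊞ X)) ⊞ Y ≅ (V ⊞ (W ⊞ Y)) ⊞ X
  ⊞-exchange = reindex exchange exchange involutive involutive
    (λ ((v , w , x) , y) → (v , w , y) , x) (λ ((v , w , y) , x) → (v , w , x) , y)
    where
    exchange : ∀ {A B C D : Set} → (A ⊎ (B ⊎ C)) ⊎ D → (A ⊎ (B ⊎ D)) ⊎ C
    exchange (inj₁ (inj₁ a))        = inj₁ (inj₁ a)
    exchange (inj₁ (inj₂ (inj₁ b))) = inj₁ (inj₂ (inj₁ b))
    exchange (inj₁ (inj₂ (inj₂ c))) = inj₂ c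
    exchange (inj₂ d)               = inj₁ (inj₂ (inj₂ d))

    involutive : ∀ {A B C D : Set} (z : (A ⊎ (B ⊎ C)) ⊎ D) → exchange (exchange z) ≡ z
    involutive (inj₁ (inj₁ _))        = refl
    involutive (inj₁ (inj₂ (inj₁ _))) = refl
    involutive (inj₁ (inj₂ (inj₂ _))) = refl
    involutive (inj₂ _)               = refl

  weighted-linear : (h : J → Carrier) (σ : J → I) → IsLinear (λ f j → h j * f (σ j))
  weighted-linear h σ = record
    { φ-cong = λ f≈g j → *-congˡ (f≈g (σ j))
    ; φ-+    = λ f g j → distribˡ (h j) _ _
    ; φ-*    = λ a f j → solve 3 (λ h a y → h :* (a :* y) := a :* (h :* y)) ≈-refl (h j) a (f (σ j))
    }

  +-linear : ∀ {φ ψ : (I → Carrier) → (J → Carrier)} → IsLinear φ → IsLinear ψ →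
             IsLinear (λ f j → φ f j + ψ f j)
  +-linear φ-linear ψ-linear = record
    { φ-cong = λ f≈g j → +-cong (φ.φ-cong f≈g j) (ψ.φ-cong f≈g j)
    ; φ-+    = λ f g j → ≈-trans (+-cong (φ.φ-+ f g j) (ψ.φ-+ f g j)) (interchange _ _ _ _)
    ; φ-*    = λ a f j → ≈-trans (+-cong (φ.φ-* a f j) (ψ.φ-* a f j)) (≈-sym (distribˡ a _ _))
    }
    where
    module φ = IsLinear φ-linear
    module ψ = IsLinear ψ-linear
    open import Algebra.Properties.CommutativeSemigroup +-commutativeSemigroup using (interchange)

  *-zero : ∀ a {y} → y ≈ 0# → a * y ≈ 0#
  *-zero a y≈0 = ≈-trans (*-congˡ y≈0) (zeroʳ a)

  +-zero : ∀ {y z} → y ≈ 0# → z ≈ 0# → y + z ≈ 0#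
  +-zero y≈0 z≈0 = ≈-trans (+-cong y≈0 z≈0) (+-identityʳ 0#)

  -‿zero : ∀ {y z} → y ≈ 0# → z ≈ 0# → y - z ≈ 0#
  -‿zero y≈0 z≈0 = ≈-trans (+-cong y≈0 (-‿cong z≈0)) (-‿inverseʳ 0#)

  +⇒- : ∀ {y z w} → y + z ≈ w → y ≈ w - z
  +⇒- {y} {z} eq = ≈-trans (solve 2 (λ y z → y := (y :+ z) :- z) ≈-refl y z) (+-congʳ eq)

  -≈0⇒≈ : ∀ {y z} → y - z ≈ 0# → y ≈ z
  -≈0⇒≈ {y} {z} eq = begin
    y            ≈⟨ solve 2 (λ y z → y := (y :- z) :+ z) ≈-refl y z ⟩
    (y - z) + z  ≈⟨ +-congʳ eq ⟩
    0# + z       ≈⟨ +-identityˡ z ⟩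
    z            ∎

  ≈⇒-≈0 : ∀ {y z} → y ≈ z → y - z ≈ 0#
  ≈⇒-≈0 {y} {z} eq = ≈-trans (+-congʳ eq) (-‿inverseʳ z)

  -- The recurrence of the eigenvectors of paths and cycles

  module Recurrence (x : Carrier) where

    -- An eigenvector extended to a sequence obeys the recurrence only as far as the graph reaches,
    -- hence the bound.
    SatisfiesBelow : ℕ → (ℕ → Carrier) → Set ℓ
    SatisfiesBelow N g = ∀ {k} → k ℕ.< N → g (2 ℕ.+ k) + g k ≈ x * g (1 ℕ.+ k)

    Satisfies : (ℕ → Carrier) → Set ℓ
    Satisfies g = ∀ k → g (2 ℕ.+ k) + g k ≈ x * g (1 ℕ.+ k)

    solutions-agree : ∀ {g h} N → SatisfiesBelow N g → SatisfiesBelow N h → g 0 ≈ h 0 → g 1 ≈ h 1 →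
             ∀ k → k ℕ.≤ N → g k ≈ h k × g (suc k) ≈ h (suc k)
    solutions-agree         N rec-g rec-h p q zero    _   = p , q
    solutions-agree {g} {h} N rec-g rec-h p q (suc k) k<N
      with p′ , q′ ← solutions-agree {g} {h} N rec-g rec-h p q k (ℕ.<⇒≤ k<N) = q′ , (begin
      g (2 ℕ.+ k)              ≈⟨ +⇒- (rec-g k<N) ⟩
      x * g (1 ℕ.+ k) - g k    ≈⟨ +-cong (*-congˡ q′) (-‿cong p′) ⟩
      x * h (1 ℕ.+ k) - h k    ≈⟨ +⇒- (rec-h k<N) ⟨
      h (2 ℕ.+ k)              ∎)

    solution : Carrier → Carrier → ℕ → Carrier
    solution a b 0             = a
    solution a b 1             = b
    solution a b (suc (suc k)) = x * solution a b (suc k) - solution a b k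

    -- u (suc k) is the Chebyshev polynomial of the second kind U_k at x / 2.
    u w : ℕ → Carrier
    u = solution 0# 1#
    w = solution 1# 0#

    -- `w` and `u` are the fundamental solutions, and `f` holds the values at 0 and 1. As a
    -- combination of the two, the solution is visibly linear in `f`.
    solve-for : (⊤ ⊎ ⊤ → Carrier) → ℕ → Carrier
    solve-for f k = w k * f (inj₁ tt) + u k * f (inj₂ tt)

    solve-for-0 : ∀ f → solve-for f 0 ≈ f (inj₁ tt)
    solve-for-0 f = ≈-trans (+-cong (*-identityˡ _) (zeroˡ _)) (+-identityʳ _)

    solve-for-1 : ∀ f → solve-for f 1 ≈ f (inj₂ tt)
    solve-for-1 f = ≈-trans (+-cong (zeroˡ _) (*-identityˡ _)) (+-identityˡ _)

    scaled-satisfies : ∀ c {g} → Satisfies g → Satisfies (λ k → g k * c)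
    scaled-satisfies c {g} rec k = begin
      g (2 ℕ.+ k) * c + g k * c  ≈⟨ distribʳ c _ _ ⟨
      (g (2 ℕ.+ k) + g k) * c    ≈⟨ *-congʳ (rec k) ⟩
      x * g (1 ℕ.+ k) * c        ≈⟨ *-assoc x _ c ⟩
      x * (g (1 ℕ.+ k) * c)      ∎

    solution-satisfies : ∀ a b → Satisfies (solution a b)
    solution-satisfies a b k = solve 2 (λ y z → (y :- z) :+ z := y) ≈-refl _ _

    solve-for-satisfies : ∀ f → Satisfies (solve-for f)
    solve-for-satisfies f k = begin
      (w (2 ℕ.+ k) * a + u (2 ℕ.+ k) * b) + (w k * a + u k * b)
        ≈⟨ solve 4 (λ y z v w → (y :+ z) :+ (v :+ w) := (y :+ v) :+ (z :+ w)) ≈-refl _ _ _ _ ⟩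
      (w (2 ℕ.+ k) * a + w k * a) + (u (2 ℕ.+ k) * b + u k * b)
        ≈⟨ +-cong (scaled-satisfies a (solution-satisfies 1# 0#) k)
                  (scaled-satisfies b (solution-satisfies 0# 1#) k) ⟩
      x * (w (1 ℕ.+ k) * a) + x * (u (1 ℕ.+ k) * b)
        ≈⟨ distribˡ x _ _ ⟨
      x * (w (1 ℕ.+ k) * a + u (1 ℕ.+ k) * b) ∎
      where
      a = f (inj₁ tt)
      b = f (inj₂ tt)

    -- If g k = z^k with x = z + 1/z, then spread g k = (z - 1/z) z^k.
    spread : (ℕ → Carrier) → ℕ → Carrier
    spread g k = ⟦ 2 , 0 ⟧ * g (1 ℕ.+ k) - x * g k

    -- The identity for T^m - T^-m, applied at position `p`; `j` stands for p - m. For fixed `p`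
    -- both sides obey the recurrence of `u` in `m`, so the induction lowers `m` by one or two and
    -- raises `j` by as much.
    reflect : ∀ {g} → Satisfies g → ∀ m j {p} → p ≡ m ℕ.+ j → g (m ℕ.+ p) - g j ≈ u m * spread g p
    reflect {g} rec 0 j refl = ≈-trans (-‿inverseʳ (g j)) (≈-sym (zeroˡ _))
    reflect {g} rec 1 j refl = begin
      g (2 ℕ.+ j) - g j
        ≈⟨ solve 2 (λ y z → y :- z := con (2 , 0) :* y :- (y :+ z)) ≈-refl _ _ ⟩
      ⟦ 2 , 0 ⟧ * g (2 ℕ.+ j) - (g (2 ℕ.+ j) + g j)
        ≈⟨ +-congˡ (-‿cong (rec j)) ⟩
      spread g (suc j)
        ≈⟨ *-identityˡ _ ⟨
      1# * spread g (suc j) ∎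
    reflect {g} rec (suc (suc m)) j {p} p≡ = begin
      g (2 ℕ.+ m ℕ.+ p) - g j
        -- The recurrence is used forwards at the upper index and, being symmetric, backwards at
        -- `j`.
        ≈⟨ +-cong (+⇒- (rec (m ℕ.+ p))) (-‿cong (+⇒- (≈-trans (+-comm _ _) (rec j)))) ⟩
      (x * g (1 ℕ.+ m ℕ.+ p) - g (m ℕ.+ p)) - (x * g (1 ℕ.+ j) - g (2 ℕ.+ j))
        ≈⟨ solve 5 (λ x a b c d → (x :* a :- b) :- (x :* c :- d) := x :* (a :- c) :- (b :- d)) ≈-refl x _ _ _ _ ⟩
      x * (g (1 ℕ.+ m ℕ.+ p) - g (1 ℕ.+ j)) - (g (m ℕ.+ p) - g (2 ℕ.+ j))
        ≈⟨ +-cong (*-congˡ (reflect rec (suc m) (suc j) (trans p≡ (cong suc (sym (ℕ.+-suc m j))))))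
                  (-‿cong (reflect rec m (2 ℕ.+ j)
                    (trans p≡ (sym (trans (ℕ.+-suc m (suc j)) (cong suc (ℕ.+-suc m j))))))) ⟩
      x * (u (1 ℕ.+ m) * spread g p) - u m * spread g p
        ≈⟨ solve 4 (λ x a b d → x :* (a :* d) :- b :* d := (x :* a :- b) :* d) ≈-refl x _ _ _ ⟩
      u (2 ℕ.+ m) * spread g p ∎

    spread-satisfies : ∀ c {g} → Satisfies g → Satisfies (λ k → c * spread g k)
    spread-satisfies c {g} rec k = begin
      c * (⟦ 2 , 0 ⟧ * g (3 ℕ.+ k) - x * g (2 ℕ.+ k)) + c * (⟦ 2 , 0 ⟧ * g (1 ℕ.+ k) - x * g k)
        ≈⟨ solve 6 (λ c x g3 g2 g1 g0 →
             c :* (con (2 , 0) :* g3 :- x :* g2) :+ c :* (con (2 , 0) :* g1 :- x :* g0) :=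
             c :* (con (2 , 0) :* (g3 :+ g1) :- x :* (g2 :+ g0))) ≈-refl c x _ _ _ _ ⟩
      c * (⟦ 2 , 0 ⟧ * (g (3 ℕ.+ k) + g (1 ℕ.+ k)) - x * (g (2 ℕ.+ k) + g k))
        ≈⟨ *-congˡ (+-cong (*-congˡ (rec (suc k))) (-‿cong (*-congˡ (rec k)))) ⟩
      c * (⟦ 2 , 0 ⟧ * (x * g (2 ℕ.+ k)) - x * (x * g (1 ℕ.+ k)))
        ≈⟨ solve 4 (λ c x g2 g1 →
             c :* (con (2 , 0) :* (x :* g2) :- x :* (x :* g1)) :=
             x :* (c :* (con (2 , 0) :* g2 :- x :* g1))) ≈-refl c x _ _ ⟩
      x * (c * spread g (1 ℕ.+ k)) ∎

    vanish-upwards : ∀ {g} → Satisfies g → g 0 ≈ 0# → g 1 ≈ 0# → ∀ k → g k ≈ 0# × g (suc k) ≈ 0#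
    vanish-upwards rec p q zero = p , q
    vanish-upwards rec p q (suc k) with p′ , q′ ← vanish-upwards rec p q k =
      q′ , ≈-trans (+⇒- (rec k)) (-‿zero (*-zero x q′) p′)

    -- T is invertible: the coefficient of `g k` in the recurrence is 1.
    vanish-downwards : ∀ {g} → Satisfies g → ∀ k → g k ≈ 0# → g (suc k) ≈ 0# → g 0 ≈ 0# × g 1 ≈ 0#
    vanish-downwards rec zero    p q = p , q
    vanish-downwards rec (suc k) p q = vanish-downwards rec k
      (≈-trans (+⇒- (≈-trans (+-comm _ _) (rec k))) (-‿zero (*-zero x p) q)) p

    -- The two rows of the matrix T - T^-1, acting on the initial values (a, b): T maps them to (b,
    -- x b - a) and T^-1 to (x a - b, a).
    spread₀ spread₁ : (⊤ ⊎ ⊤ → Carrier) → Carrier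
    spread₀ f = ⟦ 2 , 0 ⟧ * f (inj₂ tt) - x * f (inj₁ tt)
    spread₁ f = x * f (inj₂ tt) - ⟦ 2 , 0 ⟧ * f (inj₁ tt)

    spread-0 : ∀ f → spread (solve-for f) 0 ≈ spread₀ f
    spread-0 f = +-cong (*-congˡ (solve-for-1 f)) (-‿cong (*-congˡ (solve-for-0 f)))

    spread-1 : ∀ f → spread (solve-for f) 1 ≈ spread₁ f
    spread-1 f = begin
      ⟦ 2 , 0 ⟧ * solve-for f 2 - x * solve-for f 1
        ≈⟨ +-congʳ (*-congˡ (+⇒- (solve-for-satisfies f 0))) ⟩
      ⟦ 2 , 0 ⟧ * (x * solve-for f 1 - solve-for f 0) - x * solve-for f 1
        ≈⟨ solve 3 (λ x a b → con (2 , 0) :* (x :* b :- a) :- x :* b := x :* b :- con (2 , 0) :* a) ≈-refl x _ _ ⟩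
      x * solve-for f 1 - ⟦ 2 , 0 ⟧ * solve-for f 0
        ≈⟨ +-cong (*-congˡ (solve-for-1 f)) (-‿cong (*-congˡ (solve-for-0 f))) ⟩
      spread₁ f ∎

    -- A solution that is zero at 0 is a multiple of `u`; its zero at `m` is the boundary condition
    -- at the other end. The single parameter is its value at 1.
    Dirichlet : ℕ → Subset ⊤
    Dirichlet m f = u m * f tt ≈ 0#

    Periodic : ℕ → Subset (⊤ ⊎ ⊤)
    Periodic n f = solve-for f n ≈ f (inj₁ tt) × solve-for f (suc n) ≈ f (inj₂ tt)

    -- The kernel of c (T - T^-1): for `c` equal to 1 it is the summand shared by all cycles, for
    -- `u m` it is the space of solutions with period 2m.
    SpreadKernel : Carrier → Subset (⊤ ⊎ ⊤)
    SpreadKernel c f = c * spread₀ f ≈ 0# × c * spread₁ f ≈ 0#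

    -- By `reflect`, period 2m at the positions 0 and 1 says that `u m` times the spread vanishes at
    -- `m` and `m + 1`. This product is itself a solution, so it vanishes at 0 and 1 as well.
    periodic⇒kernel : ∀ m f → Periodic (m ℕ.+ m) f → SpreadKernel (u m) f
    periodic⇒kernel m f (p , q) =
      let y , z = vanish-downwards (spread-satisfies (u m) rec) m
            (≈-trans (≈-sym (reflect rec m 0 (sym (ℕ.+-identityʳ m))))
                     (≈⇒-≈0 (≈-trans p (≈-sym (solve-for-0 f)))))
            (≈-trans (≈-sym (reflect rec m 1 (ℕ.+-comm 1 m)))
                     (≈⇒-≈0 (≈-trans (reflexive (cong (solve-for f) (ℕ.+-suc m m)))
                                     (≈-trans q (≈-sym (solve-for-1 f))))))
      in ≈-trans (*-congˡ (≈-sym (spread-0 f))) y , ≈-trans (*-congˡ (≈-sym (spread-1 f))) z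
      where rec = solve-for-satisfies f

    kernel⇒periodic : ∀ m f → SpreadKernel (u m) f → Periodic (m ℕ.+ m) f
    kernel⇒periodic m f (p , q) =
      let y , z = vanish-upwards (spread-satisfies (u m) rec)
            (≈-trans (*-congˡ (spread-0 f)) p) (≈-trans (*-congˡ (spread-1 f)) q) m
      in ≈-trans (-≈0⇒≈ (≈-trans (reflect rec m 0 (sym (ℕ.+-identityʳ m))) y)) (solve-for-0 f)
       , ≈-trans (reflexive (cong (solve-for f) (sym (ℕ.+-suc m m))))
        (≈-trans (-≈0⇒≈ (≈-trans (reflect rec m 1 (ℕ.+-comm 1 m)) z)) (solve-for-1 f))
      where rec = solve-for-satisfies f

    discriminant : Carrier
    discriminant = x * x - ⟦ 4 , 0 ⟧

    -- The matrix T - T^-1 is applied a second time; its square is multiplication by `discriminant`.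
    discriminant-kills : ∀ c f → SpreadKernel c f → ∀ j → c * (discriminant * f j) ≈ 0#
    discriminant-kills c f (y , z) (inj₁ tt) = ≈-trans
      (solve 4 (λ x c a b → c :* ((x :* x :- con (4 , 0)) :* a) :=
         con (2 , 0) :* (c :* (x :* b :- con (2 , 0) :* a))
         :- x :* (c :* (con (2 , 0) :* b :- x :* a))) ≈-refl x c _ (f (inj₂ tt)))
      (-‿zero (*-zero _ z) (*-zero _ y))
    discriminant-kills c f (y , z) (inj₂ tt) = ≈-trans
      (solve 4 (λ x c a b → c :* ((x :* x :- con (4 , 0)) :* b) :=
         x :* (c :* (x :* b :- con (2 , 0) :* a))
         :- con (2 , 0) :* (c :* (con (2 , 0) :* b :- x :* a))) ≈-refl x c (f (inj₁ tt)) _)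
      (-‿zero (*-zero _ z) (*-zero _ y))

    Coprime : Carrier → Carrier → Set _
    Coprime y z = ∃₂ λ r q → r * y + q * z ≈ 1#

    -- The Bézout identity splits f into r u f + q δ f, with u for `u m` and δ for `discriminant`.
    -- The first part is killed by T - T^-1, the second by u. As u is a scalar, its kernel on pairs
    -- of initial values is two copies of `Dirichlet m`.
    periodic≅ : ∀ m → Coprime (u m) discriminant →
                Periodic (m ℕ.+ m) ≅ SpreadKernel 1# ⊞ (Dirichlet m ⊞ Dirichlet m)
    periodic≅ m (r , q , bezout) = record
      { to          = project
      ; from        = λ g j → g (inj₁ j) + g (inj₂ j)
      ; to-linear   = weighted-linear _ _
      ; from-linear = +-linear (reindex-linear inj₁) (reindex-linear inj₂)
      ; to-∈        = λ {f} f∈ → let k = periodic⇒kernel m f f∈ in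
          project-kernel f k , project-dirichlet f k (inj₁ tt) , project-dirichlet f k (inj₂ tt)
      ; from-∈      = λ {g} (k , d) → kernel⇒periodic m (λ j → g (inj₁ j) + g (inj₂ j)) (sum-kernel g k d)
      ; from∘to     = λ {f} _ j → resolve (f j)
      ; to∘from     = λ { {g} (k , d) (inj₁ j) → project-sum₁ g k d j
                        ; {g} (k , d) (inj₂ j) → project-sum₂ g k d j }
      }
      where
      project : (⊤ ⊎ ⊤ → Carrier) → ((⊤ ⊎ ⊤) ⊎ (⊤ ⊎ ⊤) → Carrier)
      project f j = [ (λ _ → r * u m) , (λ _ → q * discriminant) ] j * f ([ id , id ] j)

      resolve : ∀ y → r * u m * y + q * discriminant * y ≈ y
      resolve y = ≈-trans (≈-sym (distribʳ y _ _)) (≈-trans (*-congʳ bezout) (*-identityˡ y))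

      project-kernel : ∀ f → SpreadKernel (u m) f → SpreadKernel 1# (project f ∘ inj₁)
      project-kernel f (y , z) =
        ≈-trans (*-identityˡ _) (≈-trans
          (solve 5 (λ x r u a b → con (2 , 0) :* (r :* u :* b) :- x :* (r :* u :* a) :=
             r :* (u :* (con (2 , 0) :* b :- x :* a))) ≈-refl x r (u m) _ _)
          (*-zero r y)) ,
        ≈-trans (*-identityˡ _) (≈-trans
          (solve 5 (λ x r u a b → x :* (r :* u :* b) :- con (2 , 0) :* (r :* u :* a) :=
             r :* (u :* (x :* b :- con (2 , 0) :* a))) ≈-refl x r (u m) _ _)
          (*-zero r z))

      project-dirichlet : ∀ f → SpreadKernel (u m) f → ∀ j → u m * (q * discriminant * f j) ≈ 0#
      project-dirichlet f k j = ≈-trans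
        (solve 4 (λ u q δ a → u :* (q :* δ :* a) := q :* (u :* (δ :* a))) ≈-refl (u m) q discriminant (f j))
        (*-zero q (discriminant-kills (u m) f k j))

      module _ (g : (⊤ ⊎ ⊤) ⊎ (⊤ ⊎ ⊤) → Carrier) (k : SpreadKernel 1# (g ∘ inj₁))
               (d : (Dirichlet m ⊞ Dirichlet m) (g ∘ inj₂)) where

        dirichlet : ∀ j → u m * g (inj₂ j) ≈ 0#
        dirichlet (inj₁ tt) = proj₁ d
        dirichlet (inj₂ tt) = proj₂ d

        killed : ∀ j → discriminant * g (inj₁ j) ≈ 0#
        killed j = ≈-trans (≈-sym (*-identityˡ _)) (discriminant-kills 1# (g ∘ inj₁) k j)

        sum-kernel : SpreadKernel (u m) (λ j → g (inj₁ j) + g (inj₂ j))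
        sum-kernel =
          ≈-trans
            (solve 6 (λ x u a b c d → u :* (con (2 , 0) :* (b :+ d) :- x :* (a :+ c)) :=
               u :* (con (2 , 0) :* b :- x :* a) :+ (con (2 , 0) :* (u :* d) :- x :* (u :* c)))
               ≈-refl x (u m) _ _ _ _)
            (+-zero (*-zero _ (≈-trans (≈-sym (*-identityˡ _)) (proj₁ k)))
                    (-‿zero (*-zero _ (proj₂ d)) (*-zero _ (proj₁ d)))) ,
          ≈-trans
            (solve 6 (λ x u a b c d → u :* (x :* (b :+ d) :- con (2 , 0) :* (a :+ c)) :=
               u :* (x :* b :- con (2 , 0) :* a) :+ (x :* (u :* d) :- con (2 , 0) :* (u :* c)))
               ≈-refl x (u m) _ _ _ _)
            (+-zero (*-zero _ (≈-trans (≈-sym (*-identityˡ _)) (proj₂ k)))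
                    (-‿zero (*-zero _ (proj₂ d)) (*-zero _ (proj₁ d))))

        -- `u m` kills the second summand, and `discriminant` kills the first, so the missing Bézout
        -- term may be added freely.
        project-sum₁ : ∀ j → r * u m * (g (inj₁ j) + g (inj₂ j)) ≈ g (inj₁ j)
        project-sum₁ j = begin
          r * u m * (g (inj₁ j) + g (inj₂ j))
            ≈⟨ solve 6 (λ r u q δ a c → r :* u :* (a :+ c) :=
                 (r :* u :* a :+ q :* δ :* a) :+ (r :* (u :* c) :- q :* (δ :* a)))
                 ≈-refl r (u m) q discriminant _ _ ⟩
          (r * u m * g (inj₁ j) + q * discriminant * g (inj₁ j)) +
          (r * (u m * g (inj₂ j)) - q * (discriminant * g (inj₁ j)))
            ≈⟨ +-cong (resolve _) (-‿zero (*-zero r (dirichlet j)) (*-zero q (killed j))) ⟩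
          g (inj₁ j) + 0#
            ≈⟨ +-identityʳ _ ⟩
          g (inj₁ j) ∎

        project-sum₂ : ∀ j → q * discriminant * (g (inj₁ j) + g (inj₂ j)) ≈ g (inj₂ j)
        project-sum₂ j = begin
          q * discriminant * (g (inj₁ j) + g (inj₂ j))
            ≈⟨ solve 6 (λ r u q δ a c → q :* δ :* (a :+ c) :=
                 (r :* u :* c :+ q :* δ :* c) :+ (q :* (δ :* a) :- r :* (u :* c)))
                 ≈-refl r (u m) q discriminant _ _ ⟩
          (r * u m * g (inj₂ j) + q * discriminant * g (inj₂ j)) +
          (q * (discriminant * g (inj₁ j)) - r * (u m * g (inj₂ j)))
            ≈⟨ +-cong (resolve _) (-‿zero (*-zero q (killed j)) (*-zero r (dirichlet j))) ⟩
          g (inj₂ j) + 0#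
            ≈⟨ +-identityʳ _ ⟩
          g (inj₂ j) ∎

    -- Coprimality of `u m` and x² - 4 for even m

    ⟦suc⟧ : ∀ n → ⟦ suc n , 0 ⟧ ≈ ⟦ 1 , 0 ⟧ + ⟦ n , 0 ⟧
    ⟦suc⟧ n = _-Raw-AlmostCommutative⟶_.+-homo morphism (1 , 0) (n , 0)

    -- At x = ±2 this is U_{2n-1}(±1) = ±2n.
    u-even : ∀ n → ∃ λ b → u (n ℕ.* 2) ≈ ⟦ n , 0 ⟧ * x + discriminant * b
    u-even zero          = 0# , ≈-sym (+-zero
      (≈-trans (*-congʳ (_-Raw-AlmostCommutative⟶_.0-homo morphism)) (zeroˡ x)) (zeroʳ _))
    u-even 1             = 0# , (begin
      x * 1# - 0#                        ≈⟨ solve 3 (λ x o z → x :* o :- z := o :* x :- z) ≈-refl x 1# 0# ⟩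
      1# * x - 0#                        ≈⟨ +-cong (*-congʳ (≈-sym 1-homo)) -0≈ ⟩
      ⟦ 1 , 0 ⟧ * x + discriminant * 0#  ∎)
      where
      open _-Raw-AlmostCommutative⟶_ morphism using (1-homo)
      -0≈ : - 0# ≈ discriminant * 0#
      -0≈ = ≈-trans (≈-sym (+-identityˡ _)) (≈-trans (-‿inverseʳ 0#) (≈-sym (zeroʳ _)))
    u-even (suc (suc n)) with b₀ , eq₀ ← u-even n | b₁ , eq₁ ← u-even (suc n) = _ , (begin
      x * (x * u₂ - u₁) - u₂
        ≈⟨ solve 3 (λ x u₂ u₁ → x :* (x :* u₂ :- u₁) :- u₂ := (x :* x :- con (1 , 0)) :* u₂ :- x :* u₁) ≈-refl x u₂ u₁ ⟩
      (x * x - ⟦ 1 , 0 ⟧) * u₂ - x * u₁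
        -- `x * u₁` becomes `u₂ + u₀`, which leaves even indices only.
        ≈⟨ +-congˡ (-‿cong (≈-sym (solution-satisfies 0# 1# (n ℕ.* 2)))) ⟩
      (x * x - ⟦ 1 , 0 ⟧) * u₂ - (u₂ + u₀)
        ≈⟨ +-cong (*-congˡ eq₁′) (-‿cong (+-cong eq₁′ eq₀)) ⟩
      (x * x - ⟦ 1 , 0 ⟧) * ((⟦ 1 , 0 ⟧ + ⟦ n , 0 ⟧) * x + discriminant * b₁)
        - (((⟦ 1 , 0 ⟧ + ⟦ n , 0 ⟧) * x + discriminant * b₁) + (⟦ n , 0 ⟧ * x + discriminant * b₀))
        -- Since x² - 1 = δ + 3, the value is δ u₂ + 2 u₂ - u₀. This gives the coefficient 2 (n + 1)
        -- - n and the witness u₂ + 2 b₁ - b₀.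
        ≈⟨ solve 4 (λ x n b₀ b₁ → let δ = x :* x :- con (4 , 0) ; u₂ = (con (1 , 0) :+ n) :* x :+ δ :* b₁ in
             (x :* x :- con (1 , 0)) :* u₂ :- (u₂ :+ (n :* x :+ δ :* b₀)) :=
             (con (1 , 0) :+ (con (1 , 0) :+ n)) :* x :+ δ :* (u₂ :+ (con (2 , 0) :* b₁ :- b₀)))
             ≈-refl x ⟦ n , 0 ⟧ b₀ b₁ ⟩
      (⟦ 1 , 0 ⟧ + (⟦ 1 , 0 ⟧ + ⟦ n , 0 ⟧)) * x + discriminant * _
        ≈⟨ +-congʳ (*-congʳ (≈-trans (⟦suc⟧ (suc n)) (+-congˡ (⟦suc⟧ n)))) ⟨
      ⟦ suc (suc n) , 0 ⟧ * x + discriminant * _ ∎)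
      where
      u₀ = u (n ℕ.* 2)
      u₁ = u (1 ℕ.+ n ℕ.* 2)
      u₂ = u (2 ℕ.+ n ℕ.* 2)
      eq₁′ = ≈-trans eq₁ (+-congʳ (*-congʳ (⟦suc⟧ n)))

    -- With δ = x² - 4, the combination x (n x + δ b) - (n + x b) δ equals 4n, which `i` inverts.
    u-even-coprime : ∀ n {i} → i * (⟦ 4 , 0 ⟧ * ⟦ n , 0 ⟧) ≈ 1# → Coprime (u (n ℕ.* 2)) discriminant
    u-even-coprime n {i} inverse with b , eq ← u-even n = i * x , - (i * (⟦ n , 0 ⟧ + x * b)) , (begin
      i * x * u (n ℕ.* 2) + - (i * (⟦ n , 0 ⟧ + x * b)) * discriminant
        ≈⟨ +-congʳ (*-congˡ eq) ⟩
      i * x * (⟦ n , 0 ⟧ * x + discriminant * b) + - (i * (⟦ n , 0 ⟧ + x * b)) * discriminant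
        ≈⟨ solve 4 (λ i x n b → let δ = x :* x :- con (4 , 0) in
             i :* x :* (n :* x :+ δ :* b) :+ (:- (i :* (n :+ x :* b))) :* δ := i :* (con (4 , 0) :* n))
             ≈-refl i x ⟦ n , 0 ⟧ b ⟩
      i * (⟦ 4 , 0 ⟧ * ⟦ n , 0 ⟧)
        ≈⟨ inverse ⟩
      1# ∎)

-- Eigenspaces

module Eigenspaces {c ℓ₁ ℓ₂ : Level} (ℝ : RealNumbers c ℓ₁ ℓ₂) where

  open RealNumbers ℝ using (commutativeRing; sum)
  open CommutativeRing commutativeRing hiding (zero)
    renaming (refl to ≈-refl; sym to ≈-sym; trans to ≈-trans; setoid to ≈-setoid)
  open MonoidSum +-monoid using (sum-cong-≋)
  open LinearAlgebra commutativeRing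
  open import Relation.Binary.Reasoning.Setoid ≈-setoid

  rowSum : ∀ G → Vertex G → Vector Carrier (order G) → Carrier
  rowSum G u f = sum (λ v → adjacencyMatrix ℝ G u v * f v)

  listSum : List Carrier → Carrier
  listSum = List.foldr _+_ 0#

  sum-filter : ∀ {A : Set} {P : A → Set} (P? : Decidable P) (f : A → Carrier) {n} (h : Fin n → A) →
               sum (λ i → (if does (P? (h i)) then 1# else 0#) * f (h i)) ≈
               listSum (map f (filter P? (tabulate h)))
  sum-filter P? f {zero}  h = ≈-refl
  sum-filter P? f {suc n} h with does (P? (h zero))
  ... | true  = +-cong (*-identityˡ _) (sum-filter P? f (h ∘ suc))
  ... | false = ≈-trans (+-congʳ (zeroˡ _)) (≈-trans (+-identityˡ _) (sum-filter P? f (h ∘ suc)))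

  listSum-↭ : ∀ {xs ys} → xs ↭ ys → listSum xs ≈ listSum ys
  listSum-↭ p = SetoidPerm.foldr-commMonoid ≈-setoid +-isCommutativeMonoid
    (Homogeneous.map reflexive (↭⇒↭ₛ p))

  rowSum-neighbours : ∀ {G u ns} → NeighbourList G u ns → ∀ f → rowSum G u f ≈ listSum (map f ns)
  rowSum-neighbours {G} {u} nl f =
    ≈-trans (sum-filter (adj? G u) f id) (listSum-↭ (Perm.map⁺ f (neighbours-↭ nl)))

  rowSum-cong : ∀ G u {f g} → (∀ v → f v ≈ g v) → rowSum G u f ≈ rowSum G u g
  rowSum-cong G u f≈g = sum-cong-≋ (λ v → *-congˡ (f≈g v))

  rowSum-component : ∀ {G H} (ι : Component G H) → let open Component ι in
                     ∀ u f → rowSum H (φ u) f ≈ rowSum G u (f ∘ φ)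
  rowSum-component {G} ι u f = begin
    _                                      ≈⟨ rowSum-neighbours (map-neighbours neighbours-list) f ⟩
    listSum (map f (map φ (neighbours G u))) ≡⟨ cong listSum (List.map-∘ (neighbours G u)) ⟨
    listSum (map (f ∘ φ) (neighbours G u)) ≈⟨ rowSum-neighbours (neighbours-list {G} {u}) (f ∘ φ) ⟨
    rowSum G u (f ∘ φ)                     ∎
    where open Component ι

  module _ (x : Carrier) where

    open Recurrence x

    Eigenspace : ∀ G → Subset (Vertex G)
    Eigenspace G = InEigenspace ℝ G x

    eigen-cong : ∀ G {f g} → (∀ v → f v ≈ g v) → Eigenspace G f → Eigenspace G g
    eigen-cong G f≈g f∈ u =
      ≈-trans (≈-sym (rowSum-cong G u f≈g)) (≈-trans (f∈ u) (*-congˡ (f≈g u)))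

    ⊕-eigenspace : ∀ G H → Eigenspace (G ⊕ H) ≅ Eigenspace G ⊞ Eigenspace H
    ⊕-eigenspace G H = reindex (Fin.join p q) (splitAt p) (Fin.join-splitAt p q) (Fin.splitAt-join p q)
      (λ {f} f∈ → (λ u → ≈-trans (≈-sym (rowSum-component (left {G} {H}) u f)) (f∈ (u ↑ˡ q)))
                , (λ u → ≈-trans (≈-sym (rowSum-component (right {G} {H}) u f)) (f∈ (p ↑ʳ u))))
      (λ {g} (g₁∈ , g₂∈) → ⊕-elim {G} {H} _
        (λ u → ≈-trans (rowSum-component (left {G} {H}) u (g ∘ splitAt p))
          (eigen-cong G (λ v → reflexive (cong g (sym (Fin.splitAt-↑ˡ p v q)))) g₁∈ u))
        (λ u → ≈-trans (rowSum-component (right {G} {H}) u (g ∘ splitAt p))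
          (eigen-cong H (λ v → reflexive (cong g (sym (Fin.splitAt-↑ʳ p q v)))) g₂∈ u)))
      where
      p = order G
      q = order H

    -- Eigenspaces of paths and cycles

    extend : ∀ {n} → Vector Carrier n → Carrier → ℕ → Carrier
    extend {zero}  f d k       = d
    extend {suc n} f d zero    = f zero
    extend {suc n} f d (suc k) = extend (f ∘ suc) d k

    extend-toℕ : ∀ {n} (f : Vector Carrier n) d i → extend f d (toℕ i) ≡ f i
    extend-toℕ f d zero    = refl
    extend-toℕ f d (suc i) = extend-toℕ (f ∘ suc) d i

    extend-end : ∀ {n} (f : Vector Carrier n) d → extend f d n ≡ d
    extend-end {zero}  f d = refl
    extend-end {suc n} f d = extend-end (f ∘ suc) d

    -- A virtual vertex is added before and after, so vertex `i` moves to position `1 + i`. The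
    -- border values are zero for a path; for a cycle they repeat the last and the first vertex.
    bordered : ∀ {n} → Carrier → Vector Carrier n → Carrier → ℕ → Carrier
    bordered e f d zero    = e
    bordered e f d (suc k) = extend f d k

    bordered-satisfies : ∀ {n e d} {f : Vector Carrier n} →
      (∀ i → bordered e f d (2 ℕ.+ toℕ i) + bordered e f d (toℕ i) ≈ x * f i) →
      SatisfiesBelow n (bordered e f d)
    bordered-satisfies {e = e} {d} {f} eq {k} k<n = begin
      g (2 ℕ.+ k) + g k              ≡⟨ cong (λ k → g (2 ℕ.+ k) + g k) (Fin.toℕ-fromℕ< k<n) ⟨
      g (2 ℕ.+ toℕ i) + g (toℕ i)    ≈⟨ eq i ⟩
      x * f i                        ≡⟨ cong (x *_) (extend-toℕ f d i) ⟨
      x * g (1 ℕ.+ toℕ i)            ≡⟨ cong (λ k → x * g (1 ℕ.+ k)) (Fin.toℕ-fromℕ< k<n) ⟩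
      x * g (1 ℕ.+ k)                ∎
      where
      g = bordered e f d
      i = fromℕ< k<n

    -- The zeros at the borders stand in for the neighbours that the two ends lack. The `ℓ + 2`
    -- vertices occupy the positions from 1 to `2 + ℓ`.
    path-rowSum : ∀ {ℓ f} g → g 0 ≈ 0# → g (3 ℕ.+ ℓ) ≈ 0# → (∀ v → f v ≈ g (suc (toℕ v))) →
                  ∀ i → rowSum (pathGraph (suc ℓ)) i f ≈ g (2 ℕ.+ toℕ i) + g (toℕ i)
    path-rowSum {f = f} g g0 gℓ f≈g zero =
      ≈-trans (rowSum-neighbours (path-first {i = zero} {suc zero} refl refl) f)
              (+-cong (f≈g (suc zero)) (≈-sym g0))
    path-rowSum {ℓ} {f} g g0 gℓ f≈g (suc h) with suc (toℕ h) ℕ.≟ suc ℓ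
    ... | yes i≡ℓ = begin
      rowSum (pathGraph (suc ℓ)) (suc h) f
        ≈⟨ rowSum-neighbours (path-last {h = inject₁ h} i≡ℓ (cong suc (sym (Fin.toℕ-inject₁ h)))) f ⟩
      f (inject₁ h) + 0#
        ≈⟨ +-comm _ _ ⟩
      0# + f (inject₁ h)
        ≈⟨ +-cong (≈-trans (≈-sym gℓ) (reflexive (cong (λ k → g (2 ℕ.+ k)) (sym i≡ℓ))))
                  (≈-trans (f≈g (inject₁ h)) (reflexive (cong (g ∘ suc) (Fin.toℕ-inject₁ h)))) ⟩
      g (3 ℕ.+ toℕ h) + g (1 ℕ.+ toℕ h) ∎
    ... | no i≢ℓ = begin
      rowSum (pathGraph (suc ℓ)) (suc h) f
        ≈⟨ rowSum-neighbours (path-inner {j = j} j≡ (cong suc (sym (Fin.toℕ-inject₁ h)))) f ⟩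
      f j + (f (inject₁ h) + 0#)
        ≈⟨ +-cong (≈-trans (f≈g j) (reflexive (cong (g ∘ suc) j≡)))
                  (≈-trans (+-identityʳ _)
                    (≈-trans (f≈g (inject₁ h)) (reflexive (cong (g ∘ suc) (Fin.toℕ-inject₁ h))))) ⟩
      g (3 ℕ.+ toℕ h) + g (1 ℕ.+ toℕ h) ∎
      where
      i<ℓ = s≤s (ℕ.≤∧≢⇒< (Fin.toℕ≤pred[n] (suc h)) i≢ℓ)
      j = fromℕ< i<ℓ
      j≡ = Fin.toℕ-fromℕ< i<ℓ

    -- An eigenvector is `u` scaled by its value at the first vertex; the zero border after the last
    -- vertex is the one remaining condition.
    path-eigenspace : ∀ ℓ → Eigenspace (pathGraph (suc ℓ)) ≅ Dirichlet (3 ℕ.+ ℓ)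
    path-eigenspace ℓ = record
      { to          = λ f _ → f zero
      ; from        = λ g i → u (suc (toℕ i)) * g tt
      ; to-linear   = reindex-linear (λ _ → zero)
      ; from-linear = weighted-linear _ _
      ; to-∈        = λ {f} f∈ → ≈-trans (≈-sym (proj₂ (determined f f∈ _ ℕ.≤-refl)))
                                         (reflexive (extend-end f 0#))
      ; from-∈      = λ {g} g∈ i → ≈-trans
          (path-rowSum (λ k → u k * g tt) (zeroˡ _) g∈ (λ _ → ≈-refl) i)
          (scaled-satisfies (g tt) (solution-satisfies 0# 1#) (toℕ i))
      ; from∘to     = λ {f} f∈ i → ≈-trans (≈-sym (proj₂ (determined f f∈ (toℕ i) (ℕ.<⇒≤ (Fin.toℕ<n i)))))
                                           (reflexive (extend-toℕ f 0# i))
      ; to∘from     = λ {g} _ _ → *-identityˡ (g tt)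
      }
      where
      determined : ∀ f → Eigenspace (pathGraph (suc ℓ)) f → ∀ k → k ℕ.≤ 2 ℕ.+ ℓ →
                   bordered 0# f 0# k ≈ u k * f zero × bordered 0# f 0# (suc k) ≈ u (suc k) * f zero
      determined f f∈ = solutions-agree {h = λ k → u k * f zero} (2 ℕ.+ ℓ)
        (bordered-satisfies λ i → ≈-trans
          (≈-sym (path-rowSum {f = f} (bordered 0# f 0#) ≈-refl (reflexive (extend-end f 0#))
                   (λ v → reflexive (sym (extend-toℕ f 0# v))) i))
          (f∈ i))
        (λ {k} _ → scaled-satisfies (f zero) (solution-satisfies 0# 1#) k)
        (≈-sym (zeroˡ _)) (≈-sym (*-identityˡ _))

    cycle-rowSum : ∀ {n 3≤n f} g → g 0 ≈ g n → g 1 ≈ g (suc n) → (∀ v → f v ≈ g (suc (toℕ v))) →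
                   ∀ i → rowSum (cycleGraph n 3≤n) i f ≈ g (2 ℕ.+ toℕ i) + g (toℕ i)
    cycle-rowSum {n} {3≤n} {f} g g0 g1 f≈g i with j , i→j ← successor i | h , h→i ← predecessor i = begin
      rowSum (cycleGraph n 3≤n) i f     ≈⟨ rowSum-neighbours (cycle-neighbours {3≤n = 3≤n} i→j h→i) f ⟩
      f j + (f h + 0#)                  ≈⟨ +-cong (next i→j) (≈-trans (+-identityʳ _) (previous h→i)) ⟩
      g (2 ℕ.+ toℕ i) + g (toℕ i)       ∎
      where
      next : ∀ {j} → CyclicSucc i j → f j ≈ g (2 ℕ.+ toℕ i)
      next (inj₁ p)       = ≈-trans (f≈g _) (reflexive (cong (g ∘ suc) p))
      next (inj₂ (p , q)) = ≈-trans (f≈g _) (≈-trans (reflexive (cong (g ∘ suc) q))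
                              (≈-trans g1 (reflexive (cong (g ∘ suc) (sym p)))))

      previous : ∀ {h} → CyclicSucc h i → f h ≈ g (toℕ i)
      previous (inj₁ p)       = ≈-trans (f≈g _) (reflexive (cong g (sym p)))
      previous (inj₂ (p , q)) = ≈-trans (f≈g _) (≈-trans (reflexive (cong g p))
                                  (≈-trans (≈-sym g0) (reflexive (cong g (sym q)))))

    -- The initial values at the positions 0 and 1 are the values at the last and the first vertex.
    -- Closing the cycle makes them recur after `suc n` steps.
    cycle-eigenspace : ∀ n {3≤n} → Eigenspace (cycleGraph (suc n) 3≤n) ≅ Periodic (suc n)
    cycle-eigenspace n {3≤n} = record
      { to          = initial
      ; from        = λ g i → solve-for g (suc (toℕ i))
      ; to-linear   = reindex-linear _
      ; from-linear = +-linear (weighted-linear _ _) (weighted-linear _ _)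
      ; to-∈        = λ {f} f∈ → let p , q = determined f f∈ (suc n) ℕ.≤-refl in
          ≈-trans (≈-sym p) (reflexive (extend-last f)) , ≈-trans (≈-sym q) (reflexive (extend-end f (f zero)))
      ; from-∈      = λ {g} (p , q) i → ≈-trans
          (cycle-rowSum {3≤n = 3≤n} (solve-for g) (≈-trans (solve-for-0 g) (≈-sym p))
            (≈-trans (solve-for-1 g) (≈-sym q)) (λ _ → ≈-refl) i)
          (solve-for-satisfies g (toℕ i))
      ; from∘to     = λ {f} f∈ i → ≈-trans (≈-sym (proj₂ (determined f f∈ (toℕ i) (ℕ.<⇒≤ (Fin.toℕ<n i)))))
                                           (reflexive (extend-toℕ f (f zero) i))
      ; to∘from     = λ { {g} (p , q) (inj₁ tt) → ≈-trans (reflexive (cong (solve-for g ∘ suc) (Fin.toℕ-fromℕ n))) p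
                        ; {g} (p , q) (inj₂ tt) → solve-for-1 g }
      }
      where
      initial : Vector Carrier (suc n) → (⊤ ⊎ ⊤ → Carrier)
      initial f j = f ([ (λ _ → fromℕ n) , (λ _ → zero) ] j)

      extend-last : ∀ f {d} → extend f d n ≡ f (fromℕ n)
      extend-last f {d} = trans (cong (extend f d) (sym (Fin.toℕ-fromℕ n))) (extend-toℕ f d (fromℕ n))

      determined : ∀ f → Eigenspace (cycleGraph (suc n) 3≤n) f → ∀ k → k ℕ.≤ suc n →
                   bordered (f (fromℕ n)) f (f zero) k ≈ solve-for (initial f) k ×
                   bordered (f (fromℕ n)) f (f zero) (suc k) ≈ solve-for (initial f) (suc k)
      determined f f∈ = solutions-agree {h = solve-for (initial f)} (suc n)
        (bordered-satisfies λ i → ≈-trans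
          (≈-sym (cycle-rowSum {3≤n = 3≤n} {f} (bordered (f (fromℕ n)) f (f zero))
                   (reflexive (sym (extend-last f))) (reflexive (sym (extend-end f (f zero))))
                   (λ v → reflexive (sym (extend-toℕ f (f zero) v))) i))
          (f∈ i))
        (λ {k} _ → solve-for-satisfies (initial f) k)
        (≈-sym (solve-for-0 (initial f))) (≈-sym (solve-for-1 (initial f)))

  -- Multiplicities are invariant under linear isomorphism

  module _ {I J : Set} {φ : (I → Carrier) → (J → Carrier)} (φ-linear : IsLinear φ) where
    open IsLinear φ-linear

    φ-0 : ∀ {f} → (∀ i → f i ≈ 0#) → ∀ j → φ f j ≈ 0#
    φ-0 {f} f≈0 j = begin
      φ f j               ≈⟨ φ-cong (λ i → ≈-trans (f≈0 i) (≈-sym (zeroˡ (f i)))) j ⟩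
      φ (λ i → 0# * f i) j ≈⟨ φ-* 0# f j ⟩
      0# * φ f j          ≈⟨ zeroˡ _ ⟩
      0#                  ∎

    φ-combination : ∀ {k} (a : Vector Carrier k) (b : Fin k → (I → Carrier)) j →
                    φ (λ i → sum (λ l → a l * b l i)) j ≈ sum (λ l → a l * φ (b l) j)
    φ-combination {zero}  a b j = φ-0 (λ _ → ≈-refl) j
    φ-combination {suc k} a b j = ≈-trans (φ-+ _ _ j)
      (+-cong (φ-* (a zero) (b zero) j) (φ-combination (a ∘ suc) (b ∘ suc) j))

  multiplicity-transfer : ∀ {G H x k} → Eigenspace x G ≅ Eigenspace x H →
                          HasMultiplicity ℝ G x k → HasMultiplicity ℝ H x k
  multiplicity-transfer {x = x} e (b , b∈ , independent , spanning) =
    (λ i → to (b i)) , (λ i → to-∈ (b∈ i)) , independent′ , spanning′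
    where
    open _≅_ e
    independent′ : LinearlyIndependent ℝ (λ i → to (b i))
    independent′ a vanishes = independent a λ v → begin
      linearCombination ℝ a b v
        ≈⟨ sum-cong-≋ (λ i → *-congˡ (from∘to (b∈ i) v)) ⟨
      linearCombination ℝ a (λ i → from (to (b i))) v
        ≈⟨ φ-combination from-linear a _ v ⟨
      from (linearCombination ℝ a (λ i → to (b i))) v
        ≈⟨ φ-0 from-linear vanishes v ⟩
      0# ∎

    spanning′ : ∀ f → _ → ∃ λ a → ∀ v → f v ≈ linearCombination ℝ a (λ i → to (b i)) v
    spanning′ f f∈ with a , eq ← spanning (from f) (from-∈ f∈) = a , λ v → begin
      f v                                            ≈⟨ to∘from f∈ v ⟨
      to (from f) v                                  ≈⟨ to-cong eq v ⟩
      to (linearCombination ℝ a b) v                 ≈⟨ φ-combination to-linear a b v ⟩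
      linearCombination ℝ a (λ i → to (b i)) v       ∎

  sameSpectrum : ∀ G H → (∀ x → Eigenspace x G ≅ Eigenspace x H) → SameSpectrum ℝ G H
  sameSpectrum G H e x k = mk⇔ (multiplicity-transfer {G} {H} (e x))
                                   (multiplicity-transfer {H} {G} (≅-sym (e x)))

  -- Spectra of disjoint unions of cycles and paths

  open RealNumbers ℝ using (_<_; #⇔<⊎>; +-monoˡ-<; *-pos; isStrictPartialOrder; isHeytingField)
  open IsStrictPartialOrder isStrictPartialOrder using (<-respˡ-≈; <-respʳ-≈) renaming (trans to <-trans)
  open IsHeytingField isHeytingField using (#⇒invertible; invertible⇒#)
  open IntegerSolver commutativeRing using (⟦_⟧)
  open import Algebra.Properties.Ring ring using (-‿distribˡ-*; -0#≈0#; -‿involutive)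

  -- Positive integers are invertible

  -‿identityʳ : ∀ y → y - 0# ≈ y
  -‿identityʳ y = ≈-trans (+-congˡ -0#≈0#) (+-identityʳ y)

  -- 1 is apart from 0, so the alternative is 1 < 0; then -1 is positive, and so is its square 1.
  0<1 : 0# < 1#
  0<1 with Equivalence.to #⇔<⊎> (invertible⇒# {1#} {0#} (1# ,
    ≈-trans (*-congˡ (-‿identityʳ 1#)) (*-identityˡ 1#) ,
    ≈-trans (*-congʳ (-‿identityʳ 1#)) (*-identityˡ 1#)))
  ... | inj₂ 0<1 = 0<1
  ... | inj₁ 1<0 = <-respʳ-≈ -1*-1 (*-pos 0<-1 0<-1)
    where
    -1*-1 : (- 1#) * (- 1#) ≈ 1#
    -1*-1 = ≈-trans (≈-sym (-‿distribˡ-* 1# (- 1#)))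
           (≈-trans (-‿cong (*-identityˡ _)) (-‿involutive 1#))
    0<-1 : 0# < - 1#
    0<-1 = <-respˡ-≈ (-‿inverseʳ 1#) (<-respʳ-≈ (+-identityˡ _) (+-monoˡ-< (- 1#) 1<0))

  ⟦suc⟧-pos : ∀ n → 0# < ⟦ suc n , 0 ⟧
  ⟦suc⟧-pos n = <-respʳ-≈ (≈-sym (-‿identityʳ _)) (positive n)
    where
    open import Algebra.Properties.Semiring.Mult semiring using () renaming (_×_ to _×ᴺ_)
    positive : ∀ n → 0# < suc n ×ᴺ 1#
    positive zero    = <-respʳ-≈ (≈-sym (+-identityʳ 1#)) 0<1
    positive (suc n) = <-trans (positive n)
      (<-respˡ-≈ (+-identityˡ _) (+-monoˡ-< (suc n ×ᴺ 1#) 0<1))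

  positive⇒invertible : ∀ {y} → 0# < y → ∃ λ i → i * y ≈ 1#
  positive⇒invertible {y} 0<y
    with i , inverse , _ ← #⇒invertible (Equivalence.from #⇔<⊎> (inj₂ 0<y)) =
    i , ≈-trans (*-congˡ (≈-sym (-‿identityʳ y))) inverse

  module _ (x : Carrier) where

    open Recurrence x

    coprime : ∀ n → Coprime (u (suc n ℕ.* 2)) discriminant
    coprime n = u-even-coprime (suc n)
      -- `⟦suc⟧-pos 3` is the positivity of the 4 in `u-even-coprime`.
      (proj₂ (positive⇒invertible (*-pos (⟦suc⟧-pos 3) (⟦suc⟧-pos n))))

    -- The length is a multiple of four because coprimality is available for even half-lengths.
    cycle-dirichlet : ∀ {n 3≤n} k → n ≡ suc k ℕ.* 2 ℕ.* 2 → let m = suc k ℕ.* 2 in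
      Eigenspace x (cycleGraph n 3≤n) ≅ SpreadKernel 1# ⊞ (Dirichlet m ⊞ Dirichlet m)
    cycle-dirichlet {suc n} {3≤n} k n≡m*2 = ≅-trans (cycle-eigenspace x n {3≤n})
      (subst (λ n → Periodic n ≅ SpreadKernel 1# ⊞ (Dirichlet half ⊞ Dirichlet half))
             (sym (trans n≡m*2 (*2≡+ half))) (periodic≅ half (coprime k)))
      where
      half = suc k ℕ.* 2
      *2≡+ : ∀ m → m ℕ.* 2 ≡ m ℕ.+ m
      *2≡+ m = trans (ℕ.*-comm m 2) (cong (m ℕ.+_) (ℕ.+-identityʳ m))

    path-dirichlet : ∀ {ℓ} j → ℓ ≡ suc j ℕ.* 2 →
      Eigenspace x (pathGraph ℓ) ≅ Dirichlet (suc (suc j) ℕ.* 2)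
    path-dirichlet j refl = path-eigenspace x (suc (j ℕ.* 2))

    CyclesAndPaths-eigenspace : ∀ {n₁ n₂ ℓ} (3≤n₁ : 3 ℕ.≤ n₁) (3≤n₂ : 3 ℕ.≤ n₂) k₁ k₂ j →
      n₁ ≡ suc k₁ ℕ.* 2 ℕ.* 2 → n₂ ≡ suc k₂ ℕ.* 2 ℕ.* 2 → ℓ ≡ suc j ℕ.* 2 →
      let m₁ = suc k₁ ℕ.* 2 ; m₂ = suc k₂ ℕ.* 2 ; m₃ = suc (suc j) ℕ.* 2 in
      Eigenspace x (CyclesAndPaths 3≤n₁ 3≤n₂ ℓ) ≅
      ((SpreadKernel 1# ⊞ (Dirichlet m₁ ⊞ Dirichlet m₁)) ⊞
       (SpreadKernel 1# ⊞ (Dirichlet m₂ ⊞ Dirichlet m₂))) ⊞ (Dirichlet m₃ ⊞ Dirichlet m₃)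
    CyclesAndPaths-eigenspace {n₁} {n₂} {ℓ} 3≤n₁ 3≤n₂ k₁ k₂ j n₁≡ n₂≡ ℓ≡ =
      ≅-trans (⊕-eigenspace x (C ⊕ D) (P ⊕ P)) (⊞-cong
        (≅-trans (⊕-eigenspace x C D) (⊞-cong (cycle-dirichlet {3≤n = 3≤n₁} k₁ n₁≡) (cycle-dirichlet {3≤n = 3≤n₂} k₂ n₂≡)))
        (≅-trans (⊕-eigenspace x P P) (⊞-cong (path-dirichlet j ℓ≡) (path-dirichlet j ℓ≡))))
      where
      C = cycleGraph n₁ 3≤n₁
      D = cycleGraph n₂ 3≤n₂
      P = pathGraph ℓ

  -- The hypotheses are crossed: half of `n₂` is `ℓ′ + 2` and half of `n₃` is `ℓ + 2`, so the second
  -- cycle of each graph has the Dirichlet index of the other graph's paths.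
  CyclesAndPaths-sameSpectrum : ∀ {n₁ n₂ n₃ ℓ ℓ′}
    (3≤n₁ : 3 ℕ.≤ n₁) (3≤n₂ : 3 ℕ.≤ n₂) (3≤n₃ : 3 ℕ.≤ n₃) k i j →
    n₁ ≡ suc k ℕ.* 2 ℕ.* 2 →
    n₂ ≡ suc (suc i) ℕ.* 2 ℕ.* 2 → ℓ ≡ suc j ℕ.* 2 →
    n₃ ≡ suc (suc j) ℕ.* 2 ℕ.* 2 → ℓ′ ≡ suc i ℕ.* 2 →
    SameSpectrum ℝ (CyclesAndPaths 3≤n₁ 3≤n₂ ℓ) (CyclesAndPaths 3≤n₁ 3≤n₃ ℓ′)
  CyclesAndPaths-sameSpectrum {ℓ = ℓ} {ℓ′} 3≤n₁ 3≤n₂ 3≤n₃ k i j n₁≡ n₂≡ ℓ≡ n₃≡ ℓ′≡ =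
    sameSpectrum (CyclesAndPaths 3≤n₁ 3≤n₂ ℓ) (CyclesAndPaths 3≤n₁ 3≤n₃ ℓ′) λ x →
    let open Recurrence x
        D = λ k → Dirichlet (suc k ℕ.* 2) ⊞ Dirichlet (suc k ℕ.* 2)
    in ≅-trans
    (CyclesAndPaths-eigenspace x 3≤n₁ 3≤n₂ k (suc i) j n₁≡ n₂≡ ℓ≡)
    (≅-trans (⊞-exchange {V = SpreadKernel 1# ⊞ D k} {W = SpreadKernel 1#} {X = D (suc i)} {Y = D (suc j)})
      (≅-sym (CyclesAndPaths-eigenspace x 3≤n₁ 3≤n₃ k (suc j) i n₁≡ n₃≡ ℓ′≡)))

-- The graphs `G₁ t` and `G₂ t` for odd t = 1 + 2k

module _ (k : ℕ) where

  private
    t     = 1 ℕ.+ k ℕ.* 2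
    half′ = 7 ℕ.+ t
    half  = 3 ℕ.+ t

    3≤3+ : ∀ {n} → 3 ℕ.≤ 3 ℕ.+ n
    3≤3+ = s≤s (s≤s (s≤s z≤n))

    short : 6 ℕ.+ 2 ℕ.* t ≡ (2 ℕ.+ k) ℕ.* 2 ℕ.* 2
    short = cong (6 ℕ.+_) (ℕ.*-comm 2 t)

    long : 14 ℕ.+ 2 ℕ.* t ≡ (4 ℕ.+ k) ℕ.* 2 ℕ.* 2
    long = cong (14 ℕ.+_) (ℕ.*-comm 2 t)

    t+1 : t ℕ.+ 1 ≡ suc k ℕ.* 2
    t+1 = ℕ.+-comm t 1

    g≤long : 6 ℕ.+ 2 ℕ.* t ℕ.≤ 14 ℕ.+ 2 ℕ.* t
    g≤long = ℕ.+-monoˡ-≤ (2 ℕ.* t) (ℕ.m≤m+n 6 8)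

    g<long : 6 ℕ.+ 2 ℕ.* t ℕ.< 14 ℕ.+ 2 ℕ.* t
    g<long = ℕ.+-monoˡ-< (2 ℕ.* t) (ℕ.m<m+n 6 {8} (s≤s z≤n))

    -- The longer cycle of `G₂` brings four more vertices to each side, and each of its two shorter
    -- paths takes away two.
    evens-≡ : (half ℕ.+ half′) ℕ.+ (k ℕ.+ k) ≡
              (half ℕ.+ half) ℕ.+ ((2 ℕ.+ k) ℕ.+ (2 ℕ.+ k))
    evens-≡ = solve 1 (λ k →
      ((con 4 :+ k :* con 2) :+ (con 8 :+ k :* con 2)) :+ (k :+ k) :=
      ((con 4 :+ k :* con 2) :+ (con 4 :+ k :* con 2)) :+ ((con 2 :+ k) :+ (con 2 :+ k))) refl k
      where open +-*-Solver

    odds-≡ : (half ℕ.+ half′) ℕ.+ ((1 ℕ.+ k) ℕ.+ (1 ℕ.+ k)) ≡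
             (half ℕ.+ half) ℕ.+ ((3 ℕ.+ k) ℕ.+ (3 ℕ.+ k))
    odds-≡ = solve 1 (λ k →
      ((con 4 :+ k :* con 2) :+ (con 8 :+ k :* con 2)) :+ ((con 1 :+ k) :+ (con 1 :+ k)) :=
      ((con 4 :+ k :* con 2) :+ (con 4 :+ k :* con 2)) :+ ((con 3 :+ k) :+ (con 3 :+ k))) refl k
      where open +-*-Solver

  numberOfCycles₁ : NumberOfCycles (G₁ t) (6 ℕ.+ 2 ℕ.* t) 2
  numberOfCycles₁ = CyclesAndPaths-numberOfCycles 3≤3+ 3≤3+
    (cycle-numberOfCycles {3≤n = 3≤3+}) (cycle-numberOfCycles {3≤n = 3≤3+})

  numberOfCycles₂ : NumberOfCycles (G₂ t) (6 ℕ.+ 2 ℕ.* t) 1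
  numberOfCycles₂ = CyclesAndPaths-numberOfCycles 3≤3+ 3≤3+
    (cycle-numberOfCycles {3≤n = 3≤3+})
    -- A cycle inside the long cycle graph runs through all its vertices, which are more than g.
    (noCycles⇒0 (ℕ.<⇒≱ g<long ∘ order≤length {3≤n = 3≤3+}))

  distinguished : ∀ {c ℓ₁ ℓ₂} (ℝ : RealNumbers c ℓ₁ ℓ₂) →
                  DistinguishedPair ℝ (6 ℕ.+ 2 ℕ.* t) (G₁ t) (G₂ t)
  distinguished ℝ = record
    -- The path parameter is `2 + k` because `5 + t` is twice `3 + k`; for `G₂` it is `k` because
    -- `t + 1` is twice `1 + k`.
    { halfRegular₁        = CyclesAndPaths-halfRegular 3≤3+ 3≤3+ half half (2 ℕ.+ k) short short refl
    ; halfRegular₂        = CyclesAndPaths-halfRegular 3≤3+ 3≤3+ half half′ k short long t+1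
    ; sameSpectrum        = Eigenspaces.CyclesAndPaths-sameSpectrum ℝ 3≤3+ 3≤3+ 3≤3+
                              (1 ℕ.+ k) k (2 ℕ.+ k) short short refl long t+1
    ; sameDegreeSequences = B , C , λ
        { true  → degreeSequence-≡ (CyclesAndPaths-evens 3≤3+ 3≤3+ half half (2 ℕ.+ k) short short refl)
            (subst (OnesAndTwos C true 4) evens-≡
              (CyclesAndPaths-evens 3≤3+ 3≤3+ half half′ k short long t+1))
        ; false → degreeSequence-≡ (CyclesAndPaths-odds 3≤3+ 3≤3+ half half (2 ℕ.+ k) short short refl)
            (subst (OnesAndTwos C false 0) odds-≡
              (CyclesAndPaths-odds 3≤3+ 3≤3+ half half′ k short long t+1)) }
    ; girth₁              = CyclesAndPaths-girth 3≤3+ 3≤3+ ℕ.≤-refl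
    ; girth₂              = CyclesAndPaths-girth 3≤3+ 3≤3+ g≤long
    ; differentCounts     = 2 , 1 , numberOfCycles₁ , numberOfCycles₂ , λ ()
    }
    where
    B = CyclesAndPaths-bipartition {ℓ = 5 ℕ.+ t} 3≤3+ 3≤3+ half half (2 ℕ.+ k) short short refl
    C = CyclesAndPaths-bipartition {ℓ = t ℕ.+ 1} 3≤3+ 3≤3+ half half′ k short long t+1

open import Data.Nat using (ℕ; _+_; _*_; _≤_; _%_)
open import Data.Product using (∃₂; _×_)

mainTheorem8 : ∀ {c ℓ₁ ℓ₂ : Level} (ℝ : RealNumbers c ℓ₁ ℓ₂) (t : ℕ) → t % 2 ≡ 1 → 1 ≤ t →
    (∃₂ λ (G H : Graph) → DistinguishedPair ℝ (6 + 2 * t) G H)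
    × DistinguishedPair ℝ (6 + 2 * t) (G₁ t) (G₂ t)
    × NumberOfCycles (G₁ t) (6 + 2 * t) 2
    × NumberOfCycles (G₂ t) (6 + 2 * t) 1
mainTheorem8 ℝ t t-odd _
  -- Division with remainder turns oddness into `t ≡ 1 + k * 2`, the form in which the graphs were
  -- treated above.
  with t / 2 | trans (m≡m%n+[m/n]*n t 2) (cong (_+ t / 2 * 2) t-odd)
... | k | refl =
  (_ , _ , distinguished k ℝ) , distinguished k ℝ , numberOfCycles₁ k , numberOfCycles₂ k
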